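{- The set of fertility numbers has (natural asymptotic) density $1$ in the set of nonnegative integers.
   Context: A permutation is an ordering, written in one-line notation, of a finite set of positive integers. West's stack-sorting map $s$ is defined recursively: $s$ sends the empty permutation to itself, and if $\pi=LmR$ is a nonempty permutation with largest entry $m$, then $s(\pi)=s(L)\,s(R)\,m$. The fertility of a permutation $\pi$ is $|s^{ -1}(\pi)|$. A fertility number is a nonnegative integer $f$ such that some permutation has fertility $f$. A set $A$ of nonnegative integers has density $\delta$ if $\lim_{N\to\infty}|A\cap\{0,\ldots,N\}|/N=\delta$. -}

module Defs where

open import Data.Bool.Base using (T; true; false; if_then_else_)
open import Data.Bool.Properties using (T-≡)
open import Data.Empty using (⊥-elim)
open import Data.Integer.Base using (+_)
open import Data.List.Base using (List; []; _∷_; _++_; [_]; length)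
open import Data.List.Membership.Propositional using (_∈_)
open import Data.List.Properties using (length-++)
open import Data.List.Relation.Binary.BagAndSetEquality using (∼bag⇒↭)
open import Data.List.Membership.Propositional.Properties.WithK using (unique∧set⇒bag)
open import Data.List.Relation.Binary.Permutation.Propositional.Properties using (↭-length)
open import Data.List.Relation.Unary.All as All using (All; []; _∷_)
open import Data.List.Relation.Unary.AllPairs using ([]; _∷_)
open import Data.List.Relation.Unary.Any using (here; there)
open import Data.List.Relation.Unary.Unique.Propositional using (Unique)
open import Data.Nat.Base using (ℕ; zero; suc; _+_; _≤_; _<_; _≤ᵇ_; z≤n; s≤s; NonZero)
open import Data.Nat.Properties
open import Data.Product.Base using (_×_; _,_; ∃-syntax; Σ-syntax; proj₁; proj₂)
open import Data.Rational.Base as ℚ using (ℚ; 0ℚ)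
open import Function.Bundles using (_⇔_; mk⇔; Equivalence)
open import Level using (0ℓ)
open import Relation.Binary.PropositionalEquality
  using (_≡_; _≢_; refl; sym; trans; cong₂)
open import Relation.Nullary using (¬_; yes; no)
open import Relation.Nullary.Decidable.Core using (¬¬-excluded-middle)
open import Relation.Unary using (Pred)

-- A permutation in one-line notation; its underlying finite set is the set
-- of entries of the list, which need not be {1,…,n}.
IsPermutation : Pred (List ℕ) 0ℓ
IsPermutation π = All (1 ≤_) π × Unique π

-- splitMax x xs = (L , m , R) with x ∷ xs ≡ L ++ m ∷ R and m the largest entry.
splitMax : ℕ → List ℕ → List ℕ × ℕ × List ℕ
splitMax x []       = [] , x , []
splitMax x (y ∷ ys) =
  let (L , m , R) = splitMax y ys
  in if m ≤ᵇ x then ([] , x , y ∷ ys) else (x ∷ L , m , R)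

-- The first argument only bounds the recursion depth; any bound that is at
-- least the length of the list gives the same result (s-fuel below).
s-go : ℕ → List ℕ → List ℕ
s-go _       []       = []
s-go zero    (_ ∷ _)  = []
s-go (suc k) (x ∷ xs) =
  let (L , m , R) = splitMax x xs
  in s-go k L ++ s-go k R ++ [ m ]

-- West's stack-sorting map. Its defining recursion is s-[] and s-LmR.
s : List ℕ → List ℕ
s π = s-go (length π) π

-- P has exactly n elements: they can be listed without repetition.
HasCardinality : {X : Set} → Pred X 0ℓ → ℕ → Set
HasCardinality {X} P n =
  Σ[ xs ∈ List X ] Unique xs × (∀ x → x ∈ xs ⇔ P x) × length xs ≡ n

Preimage : List ℕ → Pred (List ℕ) 0ℓ
Preimage π σ = IsPermutation σ × s σ ≡ π

HasFertility : List ℕ → ℕ → Set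
HasFertility π f = HasCardinality (Preimage π) f

FertilityNumber : Pred ℕ 0ℓ
FertilityNumber f = ∃[ π ] IsPermutation π × HasFertility π f

_∩[0,_] : Pred ℕ 0ℓ → ℕ → Pred ℕ 0ℓ
(A ∩[0, N ]) n = n ≤ N × A n

-- lim |A ∩ {0,…,N}| / N = δ, for rational δ. Since A need not be decidable, its
-- counting function is the relation HasCardinality (A ∩[0, N ]) c rather than
-- an Agda function of N. That relation determines c (cardinality-unique), and
-- a c cannot fail to exist (¬¬-counted), so quantifying over all such c says
-- the same as naming the value of the counting function.
HasDensity : Pred ℕ 0ℓ → ℚ → Set
HasDensity A δ =
  ∀ (ε : ℚ) → 0ℚ ℚ.< ε →
  ∃[ N₀ ] (∀ N .{{_ : NonZero N}} → N₀ ≤ N →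
    ∀ c → HasCardinality (A ∩[0, N ]) c →
    ℚ.∣ (+ c ℚ./ N) ℚ.- δ ∣ ℚ.< ε)

cardinality-unique : {X : Set} {P : Pred X 0ℓ} {m n : ℕ} →
                     HasCardinality P m → HasCardinality P n → m ≡ n
cardinality-unique (xs , uxs , xs⇔ , refl) (ys , uys , ys⇔ , refl) =
  ↭-length (∼bag⇒↭ (unique∧set⇒bag uxs uys
    (λ {x} → mk⇔ (λ p → Equivalence.from (ys⇔ x) (Equivalence.to (xs⇔ x) p))
                 (λ p → Equivalence.from (xs⇔ x) (Equivalence.to (ys⇔ x) p)))))

private
  fresh : ∀ {N} {A : Pred ℕ 0ℓ} (xs : List ℕ) →
          (∀ x → x ∈ xs → x ≤ N × A x) → All (suc N ≢_) xs
  fresh xs h = All.tabulate λ { x∈ refl → <-irrefl refl (proj₁ (h _ x∈)) }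

  count-zero-yes : ∀ (A : Pred ℕ 0ℓ) → A 0 → HasCardinality (A ∩[0, 0 ]) 1
  count-zero-yes A a = [ 0 ] , [] ∷ [] ,
    (λ x → mk⇔ (λ { (here refl) → z≤n , a }) (λ { (z≤n , _) → here refl })) , refl

  count-zero-no : ∀ (A : Pred ℕ 0ℓ) → ¬ A 0 → HasCardinality (A ∩[0, 0 ]) 0
  count-zero-no A ¬a = [] , [] ,
    (λ x → mk⇔ (λ ()) (λ { (z≤n , a) → ⊥-elim (¬a a) })) , refl

  count-suc-yes : ∀ (A : Pred ℕ 0ℓ) {N c} → A (suc N) →
                  HasCardinality (A ∩[0, N ]) c →
                  HasCardinality (A ∩[0, suc N ]) (suc c)
  count-suc-yes A {N} a (xs , u , h , refl) =
    suc N ∷ xs , fresh {A = A} xs (λ x → Equivalence.to (h x)) ∷ u ,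
    (λ x → mk⇔ to (from x)) , refl
    where
    to : ∀ {x} → x ∈ suc N ∷ xs → x ≤ suc N × A x
    to (here refl) = ≤-refl , a
    to (there p)   = let (q , b) = Equivalence.to (h _) p in m≤n⇒m≤1+n q , b
    from : ∀ x → x ≤ suc N × A x → x ∈ suc N ∷ xs
    from x (q , b) with x ≟ suc N
    ... | yes eq = here eq
    ... | no  ne = there (Equivalence.from (h x) (≤-pred (≤∧≢⇒< q ne) , b))

  count-suc-no : ∀ (A : Pred ℕ 0ℓ) {N c} → ¬ A (suc N) →
                 HasCardinality (A ∩[0, N ]) c →
                 HasCardinality (A ∩[0, suc N ]) c
  count-suc-no A {N} ¬a (xs , u , h , refl) =
    xs , u , (λ x → mk⇔ to (from x)) , refl
    where
    to : ∀ {x} → x ∈ xs → x ≤ suc N × A x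
    to p = let (q , b) = Equivalence.to (h _) p in m≤n⇒m≤1+n q , b
    from : ∀ x → x ≤ suc N × A x → x ∈ xs
    from x (q , b) with x ≟ suc N
    ... | yes refl = ⊥-elim (¬a b)
    ... | no  ne   = Equivalence.from (h x) (≤-pred (≤∧≢⇒< q ne) , b)

¬¬-counted : ∀ (A : Pred ℕ 0ℓ) N → ¬ ¬ (∃[ c ] HasCardinality (A ∩[0, N ]) c)
¬¬-counted A zero    k = ¬¬-excluded-middle λ where
  (yes a) → k (1 , count-zero-yes A a)
  (no ¬a) → k (0 , count-zero-no A ¬a)
¬¬-counted A (suc N) k = ¬¬-counted A N λ where
  (c , h) → ¬¬-excluded-middle λ where
    (yes a) → k (suc c , count-suc-yes A a h)
    (no ¬a) → k (c , count-suc-no A ¬a h)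

splitMax-length : ∀ x xs → let (L , m , R) = splitMax x xs in
                  length L ≤ length xs × length R ≤ length xs
splitMax-length x []       = z≤n , z≤n
splitMax-length x (y ∷ ys) with splitMax y ys | splitMax-length y ys
... | L , m , R | p , q with m ≤ᵇ x
...   | true  = z≤n , ≤-refl
...   | false = s≤s p , m≤n⇒m≤1+n q

s-fuel : ∀ j k π → length π ≤ j → length π ≤ k → s-go j π ≡ s-go k π
s-fuel _       _       []       _       _       = refl
s-fuel (suc j) (suc k) (x ∷ xs) (s≤s p) (s≤s q) =
  let (L , m , R) = splitMax x xs
      (l , r)     = splitMax-length x xs
  in cong₂ (λ u v → u ++ v ++ [ m ])
       (s-fuel j k L (≤-trans l p) (≤-trans l q))
       (s-fuel j k R (≤-trans r p) (≤-trans r q))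

private
  splitMax-head : ∀ m R → All (_< m) R → splitMax m R ≡ ([] , m , R)
  splitMax-head m []       []        = refl
  splitMax-head m (y ∷ ys) (y<m ∷ a) with splitMax y ys | max< y ys y<m a
    where
    max< : ∀ y ys → y < m → All (_< m) ys → proj₁ (proj₂ (splitMax y ys)) < m
    max< y []       p []      = p
    max< y (z ∷ zs) p (q ∷ a) with splitMax z zs | max< z zs q a
    ... | L , m′ , R | r with m′ ≤ᵇ y
    ...   | true  = p
    ...   | false = r
  ... | L , m′ , R | r with m′ ≤ᵇ m | ≤⇒≤ᵇ (<⇒≤ r)
  ...   | true | _ = refl

  splitMax-LmR : ∀ x L m R → x < m → All (_< m) L → All (_< m) R →
                 splitMax x (L ++ m ∷ R) ≡ (x ∷ L , m , R)
  splitMax-LmR x [] m R x<m [] b rewrite splitMax-head m R b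
    with m ≤ᵇ x in eq
  ... | false = refl
  ... | true  = ⊥-elim (<⇒≱ x<m (≤ᵇ⇒≤ m x (Equivalence.from T-≡ eq)))
  splitMax-LmR x (y ∷ L) m R x<m (p ∷ a) b rewrite splitMax-LmR y L m R p a b
    with m ≤ᵇ x in eq
  ... | false = refl
  ... | true  = ⊥-elim (<⇒≱ x<m (≤ᵇ⇒≤ m x (Equivalence.from T-≡ eq)))

s-[] : s [] ≡ []
s-[] = refl

s-LmR : ∀ L m R → All (_< m) L → All (_< m) R →
        s (L ++ m ∷ R) ≡ s L ++ s R ++ [ m ]
s-LmR [] m R [] b rewrite splitMax-head m R b = refl
s-LmR (x ∷ L) m R (p ∷ a) b rewrite splitMax-LmR x L m R p a b =
  cong₂ (λ u v → u ++ v ++ [ m ])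
    (s-fuel k _ (x ∷ L) (≤-trans (m≤m+n (suc (length L)) (length R)) ≤k) ≤-refl)
    (s-fuel k _ R (≤-trans (m≤n+m (length R) (suc (length L))) ≤k) ≤-refl)
  where
  k = length (L ++ m ∷ R)
  ≤k : suc (length L) + length R ≤ k
  ≤k = ≤-reflexive (sym (trans (length-++ L) (+-suc (length L) (length R))))

{-# OPTIONS --safe #-}

-- For a permutation σ write Φ(σ) = Σ_j F(σ ⊕ 1^j) z^j, where F is the fertility
-- and σ ⊕ 1^j is σ followed by j new maxima. Cutting a word before its final
-- maximum in all possible ways shows that a new maximum in front of σ multiplies
-- Φ by z C², where C = 1 + z + 2z² + ... is the Catalan series. Starting from one
-- point and adding a - 1 maxima in front, then a behind, then c in front and
-- c + 1 behind, one finds the fertility numbers 2a and a (2a + 3 + 4c). The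
-- former are the even positive integers, the latter contain all n > 1 with
-- n ≡ 1 mod 4 (a = 1), and all n ≡ 3 mod 4 that have a prime factor p ≡ 3 mod 4
-- with n ≥ p (2p + 3).
--
-- What is left to show is that the integers all of whose prime factors below M
-- are 1 mod 4 have density tending to 0 as M grows. Let τ and β be the sums of
-- 1/n over those n < M all of whose, respectively none of whose, prime factors
-- are 1 mod 4. The products u s, with u counted by β and s free of primes below
-- M that are not 1 mod 4, are distinct, so the density is at most 1/β. Factoring
-- n < M gives H(M) ≤ τ β for the harmonic sum H. With χ the character mod 4,
-- Σ_{d ∣ n} χ(d) is nonnegative, and it is the number of divisors of n if all
-- prime factors of n are 1 mod 4. Hence τ² ≤ Σ_{de < M²} χ(d) / (de), which is
-- at most H(M²) since the sum over d alternates. So β² ≥ H(M)² / H(M²) → ∞.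

module Submission where

open import Defs
import Data.Integer.Base as ℤ
import Data.Integer.Properties as ℤ
open import Data.Empty using (⊥-elim)
open import Data.List.Base
  using (List; []; _∷_; _++_; [_]; _∷ʳ_; length; map; filter; applyUpTo; upTo; cartesianProduct; initLast; _∷ʳ′_)
open import Data.List.Membership.Propositional using (_∈_)
open import Data.List.Membership.Propositional.Properties
  using (∈-cartesianProduct⁺; ∈-cartesianProduct⁻; ∈-++⁺ˡ; ∈-++⁺ʳ; ∈-++⁻; ∈-map⁺; ∈-map⁻; ∈-∃++; ∈-upTo⁺; ∈-upTo⁻; ∈-filter⁺)
open import Data.List.Properties
  using (length-++; length-map; length-applyUpTo; ++-assoc; ++-identityʳ; ∷ʳ-injective; ∷ʳ-++; ∷-injective)
open import Data.List.Relation.Binary.Permutation.Propositional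
  using (_↭_; ↭-refl; ↭-sym; ↭-trans; prep; ↭⇒↭ₛ)
open import Data.List.Relation.Binary.Permutation.Propositional.Properties
  using (All-resp-↭; shift; ∷↭∷ʳ; ↭-empty-inv)
import Data.List.Relation.Binary.Permutation.Propositional.Properties as Perm
import Data.List.Relation.Binary.Permutation.Setoid.Properties as PermSetoid
open import Data.List.Relation.Unary.All as All using (All; []; _∷_)
import Data.List.Relation.Unary.All.Properties as All
open import Data.List.Relation.Unary.AllPairs using ([]; _∷_)
open import Data.List.Relation.Unary.Any using (here; there)
open import Data.List.Relation.Unary.Unique.Propositional using (Unique)
import Data.List.Relation.Unary.Unique.Propositional.Properties as Unique
open import Data.List.Reverse using (Reverse; []; _∶_∶ʳ_; reverseView)
open import Data.Nat.Base
open import Data.Nat.Coprimality using (Coprime; coprime-divisor)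
open import Data.Nat.Divisibility
open import Data.Nat.DivMod using (_%_; _/_; %-distribˡ-*; m%n<n; m≡m%n+[m/n]*n; m/n*n≤m; m*[n/m]≡n)
open import Data.Nat.Induction using (<-rec)
open import Data.Nat.ListAction using (product)
open import Data.Nat.Primality
  using (Prime; prime?; prime[2]; ¬prime[1]; euclidsLemma; prime⇒irreducible; prime⇒nonZero; prime⇒nonTrivial)
open import Data.Nat.Primality.Factorisation using (factorise)
open import Data.Nat.Properties
open import Data.Nat.Tactic.RingSolver using (solve-∀)
open import Data.Product.Base using (_×_; _,_; ∃-syntax; proj₁; proj₂)
open import Data.Rational.Base as ℚ using (ℚ; mkℚ; 0ℚ; 1ℚ; *<*)
import Data.Rational.Properties as ℚ
import Data.Rational.Unnormalised.Base as ℚᵘ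
import Data.Rational.Unnormalised.Properties as ℚᵘ
open import Data.Sum.Base using (_⊎_; inj₁; inj₂; [_,_]′)
open import Function.Base using (_∘_; id; case_of_)
open import Function.Bundles using (_⇔_; mk⇔; Equivalence)
open import Level using (0ℓ)
open import Relation.Binary.Definitions using (tri<; tri≈; tri>)
open import Relation.Binary.PropositionalEquality
  using (_≡_; _≢_; refl; sym; trans; cong; cong₂; subst; subst₂; module ≡-Reasoning)
open import Relation.Binary.PropositionalEquality.Properties using (setoid)
open import Relation.Nullary using (¬_; Dec; yes; no; contradiction)
open import Relation.Nullary.Decidable using (_×-dec_; _→-dec_; ¬?)
open import Relation.Unary using (Pred; Decidable)

open Equivalence using (to; from)

private variable
  A B : Set
  P P′ : Pred A 0ℓ
  m n : ℕ

-- Cardinalities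

card-∅ : (∀ x → ¬ P x) → HasCardinality P 0
card-∅ ¬P = [] , [] , (λ x → mk⇔ (λ ()) (⊥-elim ∘ ¬P x)) , refl

card-⇔ : (∀ x → P x ⇔ P′ x) → HasCardinality P n → HasCardinality P′ n
card-⇔ e (xs , u , xs⇔ , len) =
  xs , u , (λ x → mk⇔ (to (e x) ∘ to (xs⇔ x)) (from (xs⇔ x) ∘ from (e x))) , len

card-singleton : ∀ (x : A) → HasCardinality (_≡ x) 1
card-singleton x = [ x ] , [] ∷ [] , (λ y → mk⇔ (λ { (here eq) → eq ; (there ()) }) here) , refl

card-⊎ : (∀ x → P x → ¬ P′ x) → HasCardinality P m → HasCardinality P′ n →
         HasCardinality (λ x → P x ⊎ P′ x) (m + n)
card-⊎ disjoint (xs , u , xs⇔ , refl) (ys , v , ys⇔ , refl) =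
  xs ++ ys ,
  Unique.++⁺ u v (λ { (x∈xs , x∈ys) → disjoint _ (to (xs⇔ _) x∈xs) (to (ys⇔ _) x∈ys) }) ,
  (λ x → mk⇔ ([ inj₁ ∘ to (xs⇔ x) , inj₂ ∘ to (ys⇔ x) ]′ ∘ ∈-++⁻ xs)
             [ ∈-++⁺ˡ ∘ from (xs⇔ x) , ∈-++⁺ʳ xs ∘ from (ys⇔ x) ]′) ,
  length-++ xs

length-cartesianProduct : (xs : List A) (ys : List B) → length (cartesianProduct xs ys) ≡ length xs * length ys
length-cartesianProduct []       ys = refl
length-cartesianProduct (x ∷ xs) ys = trans (length-++ (map (x ,_) ys))
  (cong₂ _+_ (length-map (x ,_) ys) (length-cartesianProduct xs ys))

card-× : {P : Pred A 0ℓ} {P′ : Pred B 0ℓ} → HasCardinality P m → HasCardinality P′ n →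
         HasCardinality (λ (x , y) → P x × P′ y) (m * n)
card-× (xs , u , xs⇔ , refl) (ys , v , ys⇔ , refl) =
  cartesianProduct xs ys , Unique.cartesianProduct⁺ u v ,
  (λ (x , y) → mk⇔ (λ p → let (x∈ , y∈) = ∈-cartesianProduct⁻ xs ys p in to (xs⇔ x) x∈ , to (ys⇔ y) y∈)
                   (λ (p , q) → ∈-cartesianProduct⁺ (from (xs⇔ x) p) (from (ys⇔ y) q))) ,
  length-cartesianProduct xs ys

unique-map : (f : A → B) {xs : List A} → (∀ {x y} → x ∈ xs → y ∈ xs → f x ≡ f y → x ≡ y) →
             Unique xs → Unique (map f xs)
unique-map f inj []      = []
unique-map f inj (x∉ ∷ u) =
  All.map⁺ (All.tabulate λ y∈ eq → All.lookup x∉ y∈ (inj (here refl) (there y∈) eq)) ∷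
  unique-map f (λ x∈ y∈ → inj (there x∈) (there y∈)) u

card-image : (f : A → B) {P : Pred A 0ℓ} {P′ : Pred B 0ℓ} → (∀ {x y} → P x → P y → f x ≡ f y → x ≡ y) →
             (∀ y → (∃[ x ] P x × f x ≡ y) ⇔ P′ y) → HasCardinality P n → HasCardinality P′ n
card-image f inj image (xs , u , xs⇔ , len) =
  map f xs , unique-map f (λ x∈ y∈ → inj (to (xs⇔ _) x∈) (to (xs⇔ _) y∈)) u ,
  (λ y → mk⇔ (λ y∈ → let (x , x∈ , eq) = ∈-map⁻ f y∈ in to (image y) (x , to (xs⇔ x) x∈ , sym eq))
             (λ p → let (x , px , eq) = from (image y) p in subst (_∈ map f xs) eq (∈-map⁺ f (from (xs⇔ x) px)))) ,
  trans (length-map f xs) len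

-- Fertility and cuts

unique-++⁻ˡ : ∀ (xs : List A) {ys} → Unique (xs ++ ys) → Unique xs
unique-++⁻ˡ []       _       = []
unique-++⁻ˡ (x ∷ xs) (p ∷ u) = All.++⁻ˡ xs p ∷ unique-++⁻ˡ xs u

unique-++⁻ʳ : ∀ (xs : List A) {ys} → Unique (xs ++ ys) → Unique ys
unique-++⁻ʳ []       u       = u
unique-++⁻ʳ (x ∷ xs) (_ ∷ u) = unique-++⁻ʳ xs u

perm-++⁻ˡ : ∀ α {β} → IsPermutation (α ++ β) → IsPermutation α
perm-++⁻ˡ α (a , u) = All.++⁻ˡ α a , unique-++⁻ˡ α u

perm-++⁻ʳ : ∀ α {β} → IsPermutation (α ++ β) → IsPermutation β
perm-++⁻ʳ α (a , u) = All.++⁻ʳ α a , unique-++⁻ʳ α u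

perm-↭ : ∀ {α β} → α ↭ β → IsPermutation α → IsPermutation β
perm-↭ α↭β (a , u) = All-resp-↭ α↭β a , PermSetoid.Unique-resp-↭ (setoid ℕ) (↭⇒↭ₛ α↭β) u

-- Indexed by the word, so that matching on a split rewrites the word as `L ++ m ∷ R`, the form that
-- `s-LmR` expects.
data MaxSplit : List ℕ → Set where
  []      : MaxSplit []
  ⟨_,_,_⟩ : ∀ L m R → All (_< m) L → All (_< m) R → MaxSplit (L ++ m ∷ R)

maxSplit : ∀ π → Unique π → MaxSplit π
maxSplit []      _ = []
maxSplit (x ∷ π) (x∉ ∷ u) with maxSplit π u
... | [] = ⟨ [] , x , [] ⟩ [] []
... | ⟨ L , m , R ⟩ L<m R<m with <-cmp x m
...   | tri< x<m _ _ = ⟨ x ∷ L , m , R ⟩ (x<m ∷ L<m) R<m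
...   | tri≈ _ refl _ = contradiction refl (All.lookup x∉ (∈-++⁺ʳ L (here refl)))
...   | tri> _ _ x>m = ⟨ [] , x , L ++ m ∷ R ⟩ []
                         (All.++⁺ (All.map (λ l → <-trans l x>m) L<m) (x>m ∷ All.map (λ l → <-trans l x>m) R<m))

∷ʳ-shape : ∀ (xs ys : List A) z → xs ++ ys ++ [ z ] ≡ (xs ++ ys) ∷ʳ z
∷ʳ-shape xs ys z = sym (++-assoc xs ys [ z ])

-- By induction on a bound for the length, since `L` and `R` are not structurally smaller than
-- `L ++ m ∷ R`. It lets a preimage inherit bounds on entries from its image.
s-↭ : ∀ σ → Unique σ → s σ ↭ σ
s-↭ σ u = go (length σ) σ ≤-refl u
  where
  go : ∀ k σ → length σ ≤ k → Unique σ → s σ ↭ σ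
  go k σ len u with maxSplit σ u
  ... | [] = ↭-refl
  go zero    .(L ++ m ∷ R) len u | ⟨ L , m , R ⟩ L<m R<m rewrite length-++ L {m ∷ R} | +-suc (length L) (length R) = contradiction len λ ()
  go (suc k) .(L ++ m ∷ R) len u | ⟨ L , m , R ⟩ L<m R<m rewrite s-LmR L m R L<m R<m | ∷ʳ-shape (s L) (s R) m =
    ↭-trans (↭-sym (∷↭∷ʳ m (s L ++ s R)))
      (↭-trans (prep m (Perm.++⁺ (go k L (m+n≤o⇒m≤o (length L) len′) (unique-++⁻ˡ L u))
                                 (go k R (m+n≤o⇒n≤o (length L) len′) (case unique-++⁻ʳ L u of λ { (_ ∷ v) → v }))))
               (↭-sym (shift m L R)))
    where
    len′ : length L + length R ≤ k
    len′ = ≤-pred (subst (_≤ suc k) (trans (length-++ L) (+-suc (length L) (length R))) len)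

preimage-↭ : ∀ {π σ} → Preimage π σ → π ↭ σ
preimage-↭ {σ = σ} ((_ , u) , refl) = s-↭ σ u

-- The permutation hypothesis sits inside, so that counts follow from the shape of a word and
-- distinctness is checked only once, for the whole word.
Fert : List ℕ → ℕ → Set
Fert π f = IsPermutation π → HasFertility π f

Fert-[] : Fert [] 1
Fert-[] _ = card-⇔ (λ σ → mk⇔ (λ { refl → ([] , []) , refl })
                              (λ p → ↭-empty-inv (↭-sym (preimage-↭ p)))) (card-singleton [])

-- By `s-LmR` the last entry of an image is the maximum of the preimage, and what precedes it is
-- `s L ++ s R`.
s-last-max : ∀ {τ m σ} → Preimage (τ ∷ʳ m) σ →
             ∃[ L ] ∃[ R ] σ ≡ L ++ m ∷ R × All (_< m) L × All (_< m) R × τ ≡ s L ++ s R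
s-last-max {τ} {m} {σ} ((_ , u) , eq) with maxSplit σ u
s-last-max {[]}    ((_ , u) , ()) | []
s-last-max {_ ∷ _} ((_ , u) , ()) | []
s-last-max {τ} {m} ((_ , u) , eq) | ⟨ L , m′ , R ⟩ L<m R<m
  with ∷ʳ-injective (s L ++ s R) τ (trans (sym (trans (s-LmR L m′ R L<m R<m) (∷ʳ-shape (s L) (s R) m′))) eq)
... | refl , refl = L , R , refl , L<m , R<m , refl

-- Images under `s` end with their maximum.
Fert-descent : ∀ {τ m x} → m ∈ τ → x < m → Fert (τ ∷ʳ x) 0
Fert-descent {τ} {m} {x} m∈τ x<m _ = card-∅ ¬preimage
  where
  ¬preimage : ∀ σ → ¬ Preimage (τ ∷ʳ x) σ
  ¬preimage σ pre@((_ , u) , _) with s-last-max {τ} pre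
  ... | L , R , refl , L<x , R<x , refl = <-asym x<m (All.lookup
      (All-resp-↭ (↭-sym (Perm.++⁺ (s-↭ L (unique-++⁻ˡ L u)) (s-↭ R (case unique-++⁻ʳ L u of λ { (_ ∷ v) → v }))))
                  (All.++⁺ L<x R<x)) m∈τ)

-- The word α ++ β is cut in two somewhere in α (its right end included), and
-- each piece has a preimage.
CutPair : List ℕ → List ℕ → Pred (List ℕ × List ℕ) 0ℓ
CutPair α β (l , r) = ∃[ γ ] ∃[ δ ] α ≡ γ ++ δ × Preimage γ l × Preimage (δ ++ β) r

Cuts : List ℕ → List ℕ → ℕ → Set
Cuts α β f = IsPermutation (α ++ β) → HasCardinality (CutPair α β) f

cuts-[] : ∀ {β g} → Fert β g → Cuts [] β g
cuts-[] {β} {g} fβ perm = subst (HasCardinality _) (*-identityˡ g)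
  (card-⇔ (λ (l , r) → mk⇔ (λ (p , q) → [] , [] , refl , p , q)
                           (λ { ([] , [] , refl , p , q) → p , q }))
          (card-× (Fert-[] ([] , [])) (fβ perm)))

module _ {α : List ℕ} {x : ℕ} {β : List ℕ} where

  private
    Here : Pred (List ℕ × List ℕ) 0ℓ
    Here (l , r) = Preimage (α ∷ʳ x) l × Preimage β r

    join : ∀ p → Here p ⊎ CutPair α (x ∷ β) p → CutPair (α ∷ʳ x) β p
    join p (inj₁ (a , b)) = α ∷ʳ x , [] , sym (++-identityʳ _) , a , b
    join p (inj₂ (γ , δ , refl , a , b)) = γ , δ ∷ʳ x , ++-assoc γ δ [ x ] , a ,
      subst (λ π → Preimage π (proj₂ p)) (sym (∷ʳ-++ δ x β)) b

    cut : ∀ p → CutPair (α ∷ʳ x) β p → Here p ⊎ CutPair α (x ∷ β) p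
    cut p (γ , δ , eq , a , b) with initLast δ
    ... | [] = inj₁ (subst (λ π → Preimage π (proj₁ p)) (sym (trans eq (++-identityʳ γ))) a , b)
    ... | δ′ ∷ʳ′ y with ∷ʳ-injective α (γ ++ δ′) (trans eq (sym (++-assoc γ δ′ [ y ])))
    ...   | refl , refl = inj₂ (γ , δ′ , refl , a , subst (λ π → Preimage π (proj₂ p)) (∷ʳ-++ δ′ x β) b)

    disjoint : ∀ p → Here p → ¬ CutPair α (x ∷ β) p
    -- The left piece is the image of `l` in both cases, so its two lengths would have to agree.
    disjoint p ((_ , eq) , _) (γ , δ , refl , (_ , eq′) , _) =
      m≢1+m+n (length γ) (trans (cong length (trans (sym eq′) eq))
        (trans (length-++ (γ ++ δ)) (trans (+-comm _ 1) (cong suc (length-++ γ)))))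

    perm₁ : IsPermutation ((α ∷ʳ x) ++ β) → IsPermutation (α ++ x ∷ β)
    perm₁ = subst IsPermutation (∷ʳ-++ α x β)

  -- The cut at the right end of `α ∷ʳ x` contributes `f * g`; every other cut leaves `x` in the
  -- right piece, where it joins `β`.
  cuts-∷ʳ : ∀ {f g h} → Fert (α ∷ʳ x) f → Fert β g → Cuts α (x ∷ β) h → Cuts (α ∷ʳ x) β (f * g + h)
  cuts-∷ʳ f g h perm = card-⇔ (λ p → mk⇔ (join p) (cut p))
    (card-⊎ disjoint (card-× (f (perm-++⁻ˡ (α ∷ʳ x) perm)) (g (perm-++⁻ʳ (α ∷ʳ x) perm))) (h (perm₁ perm)))

  -- When `α ∷ʳ x` has no preimage, the cut at its right end contributes nothing, whatever the
  -- fertility of `β`.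
  cuts-skip : ∀ {h} → Fert (α ∷ʳ x) 0 → Cuts α (x ∷ β) h → Cuts (α ∷ʳ x) β h
  cuts-skip f h perm with f (perm-++⁻ˡ (α ∷ʳ x) perm)
  ... | [] , _ , empty , refl = card-⇔
    (λ p → mk⇔ (join p ∘ inj₂)
               ([ (λ (a , _) → case from (empty (proj₁ p)) a of λ ()) , id ]′ ∘ cut p)) (h (perm₁ perm))

++∷-injective : ∀ {m} l l′ {r r′} → All (_< m) l → All (_< m) l′ → l ++ m ∷ r ≡ l′ ++ m ∷ r′ → l ≡ l′ × r ≡ r′
++∷-injective []      []        _        _          refl = refl , refl
++∷-injective []      (x ∷ l′)  _        (x<m ∷ _)  refl = contradiction x<m (<-irrefl refl)
++∷-injective (x ∷ l) []        (x<m ∷ _) _         refl = contradiction x<m (<-irrefl refl)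
++∷-injective (x ∷ l) (x′ ∷ l′) (_ ∷ a)  (_ ∷ a′) eq with ∷-injective eq
... | refl , eq′ with ++∷-injective l l′ a a′ eq′
...   | refl , refl = refl , refl

-- Removing the maximum from a preimage leaves l and r with s l ++ s r = `τ`, and the cut is where s
-- l ends. Conversely `m` may be put between any such l and r, whose entries are below `m`.
Fert-∷ʳ : ∀ {τ m f} → All (_< m) τ → Cuts τ [] f → Fert (τ ∷ʳ m) f
Fert-∷ʳ {τ} {m} τ<m cuts perm =
  card-image (λ (l , r) → l ++ m ∷ r) injective (λ σ → mk⇔ (to′ σ) (from′ σ))
    (cuts (subst IsPermutation (sym (++-identityʳ τ)) (perm-++⁻ˡ τ perm)))
  where
  Pair : Pred (List ℕ × List ℕ) 0ℓ
  Pair = CutPair τ []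

  left< : ∀ {l r} → Pair (l , r) → All (_< m) l
  left< (γ , δ , refl , p , q) = All-resp-↭ (preimage-↭ p) (All.++⁻ˡ γ τ<m)

  right< : ∀ {l r} → Pair (l , r) → All (_< m) r
  right< (γ , δ , refl , p , q) = All-resp-↭ (preimage-↭ q) (subst (All (_< m)) (sym (++-identityʳ δ)) (All.++⁻ʳ γ τ<m))

  injective : ∀ {x y} → Pair x → Pair y → proj₁ x ++ m ∷ proj₂ x ≡ proj₁ y ++ m ∷ proj₂ y → x ≡ y
  injective {l , r} {l′ , r′} p q eq with ++∷-injective l l′ (left< p) (left< q) eq
  ... | refl , refl = refl

  to′ : ∀ σ → (∃[ x ] Pair x × proj₁ x ++ m ∷ proj₂ x ≡ σ) → Preimage (τ ∷ʳ m) σ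
  to′ _ ((l , r) , pair@(γ , δ , τ≡ , p , q) , refl) =
    perm-↭ (↭-trans (↭-sym (∷↭∷ʳ m τ)) (↭-trans (prep m τ↭) (↭-sym (shift m l r)))) perm ,
    trans (s-LmR l m r (left< pair) (right< pair)) (trans (∷ʳ-shape (s l) (s r) m)
      (cong (_∷ʳ m) (trans (cong₂ _++_ (proj₂ p) (trans (proj₂ q) (++-identityʳ δ))) (sym τ≡))))
    where
    τ↭ : τ ↭ l ++ r
    τ↭ = subst (_↭ l ++ r) (trans (cong (γ ++_) (++-identityʳ δ)) (sym τ≡))
           (Perm.++⁺ (preimage-↭ p) (preimage-↭ q))

  from′ : ∀ σ → Preimage (τ ∷ʳ m) σ → ∃[ x ] Pair x × proj₁ x ++ m ∷ proj₂ x ≡ σ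
  from′ σ pre@(permσ , _) with s-last-max {τ} pre
  ... | L , R , refl , _ , _ , τ≡ = (L , R) , (s L , s R , τ≡ , (perm-++⁻ˡ L permσ , refl) ,
          (perm-++⁻ʳ [ m ] (perm-++⁻ʳ L permσ) , sym (++-identityʳ (s R)))) , refl

-- Fertility series

infixl 5 _▷_

-- `σ ++ τ` stands for σ ⊕ 1^j. The new maxima need not be consecutive values, so `τ` remains a run
-- when the front entry of `σ` is dropped.
data Run (σ : List ℕ) : ℕ → List ℕ → Set where
  []  : Run σ 0 []
  _▷_ : ∀ {j τ m} → Run σ j τ → All (_< m) (σ ++ τ) → Run σ (suc j) (τ ∷ʳ m)

run-++ : ∀ {σ i j τ τ′} → Run σ i τ → Run (σ ++ τ) j τ′ → Run σ (j + i) (τ ++ τ′)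
run-++ {σ} {τ = τ} r []       = subst (Run σ _) (sym (++-identityʳ τ)) r
run-++ {σ} {τ = τ} r (_▷_ {τ = τ′} {m = m} r′ a) =
  subst (Run σ _) (++-assoc τ τ′ [ m ]) (run-++ r r′ ▷ subst (All _) (++-assoc σ τ τ′) a)

run-tail : ∀ {m β j τ} → Run (m ∷ β) j τ → Run β j τ
run-tail []            = []
run-tail (r ▷ (_ ∷ a)) = run-tail r ▷ a

Fert-≡ : ∀ {π π′ f} → π ≡ π′ → Fert π f → Fert π′ f
Fert-≡ refl p = p

Fert-singleton : ∀ m → Fert [ m ] 1
Fert-singleton m = Fert-∷ʳ [] (cuts-[] Fert-[])

Fert-▷ : ∀ σ τ {m f} → All (_< m) (σ ++ τ) → Cuts (σ ++ τ) [] f → Fert (σ ++ τ ∷ʳ m) f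
Fert-▷ σ τ {m} a c = Fert-≡ (++-assoc σ τ [ m ]) (Fert-∷ʳ a c)

cuts-▷ : ∀ σ τ {m β f g h} → Fert (σ ++ τ ∷ʳ m) f → Fert β g → Cuts (σ ++ τ) (m ∷ β) h →
         Cuts (σ ++ τ ∷ʳ m) β (f * g + h)
cuts-▷ σ τ {m} {β} f g h = subst (λ α → Cuts α β _) (++-assoc σ τ [ m ])
  (cuts-∷ʳ (Fert-≡ (sym (++-assoc σ τ [ m ])) f) g h)

cuts-▷-skip : ∀ σ τ {m β h} → Fert (σ ++ τ ∷ʳ m) 0 → Cuts (σ ++ τ) (m ∷ β) h → Cuts (σ ++ τ ∷ʳ m) β h
cuts-▷-skip σ τ {m} {β} f h = subst (λ α → Cuts α β _) (++-assoc σ τ [ m ])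
  (cuts-skip (Fert-≡ (sym (++-assoc σ τ [ m ])) f) h)

-- Φ(σ) = x z^J + y z^(J+1) + ...
record Profile (σ : List ℕ) (J x y : ℕ) : Set where
  field
    low : ∀ {j τ} → j < J → Run σ j τ → Fert (σ ++ τ) 0
    at₀ : ∀ {τ} → Run σ J τ → Fert (σ ++ τ) x
    at₁ : ∀ {τ} → Run σ (1 + J) τ → Fert (σ ++ τ) y

-- The coefficient of z^(J+2), kept apart from `Profile` because it is followed only through the
-- first round of maxima in front.
Profile₂ : List ℕ → ℕ → ℕ → Set
Profile₂ σ J z = ∀ {τ} → Run σ (2 + J) τ → Fert (σ ++ τ) z

-- In z C² the square of the Catalan series is C² = 1 + 2z + 5z² + ..., whence
-- the coefficients below.
module Push {m : ℕ} {β : List ℕ} {J x y : ℕ} (β≢[] : β ≢ []) (β<m : All (_< m) β) (profile : Profile β J x y) where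

  open Profile profile

  σ : List ℕ
  σ = m ∷ β

  Fert-σ : Fert σ 0
  Fert-σ with initLast β
  ... | []       = contradiction refl β≢[]
  ... | γ ∷ʳ′ b = Fert-descent (here refl) (proj₂ (All.∷ʳ⁻ β<m))

  -- Only the cuts just before and just after m survive: a longer left piece
  -- inside σ ends with a descent from m.
  cuts-σ : ∀ {γ δ v u} → Reverse γ → All (_< m) γ →
           Fert (γ ++ δ) v → Fert (m ∷ γ ++ δ) u → Cuts (m ∷ γ) δ (v + u)
  cuts-σ {v = v} {u} [] _ fv fu = subst (λ k → Cuts [ m ] _ (k + u)) (*-identityˡ v)
    (cuts-∷ʳ (Fert-singleton m) fv (cuts-[] fu))
  cuts-σ {δ = δ} (γ ∶ rs ∶ʳ b) γ<m fv fu =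
    cuts-skip {m ∷ γ} (Fert-descent (here refl) (proj₂ (All.∷ʳ⁻ γ<m)))
      (cuts-σ rs (proj₁ (All.∷ʳ⁻ γ<m)) (Fert-≡ (∷ʳ-++ γ b δ) fv) (Fert-≡ (cong (m ∷_) (∷ʳ-++ γ b δ)) fu))

  mutual

    low′ : ∀ {j τ} → j < suc J → Run σ j τ → Fert (σ ++ τ) 0
    low′ j<J []      = Fert-≡ (sym (++-identityʳ σ)) Fert-σ
    low′ (s≤s j<J) (_▷_ {τ = τ} r a) = Fert-▷ σ τ a
      (cuts-run (m≤n⇒m≤1+n j<J) r
        (Fert-≡ (sym (++-identityʳ (β ++ τ))) (low j<J (run-tail r)))
        (Fert-≡ (sym (++-identityʳ (σ ++ τ))) (low′ (m≤n⇒m≤1+n j<J) r)))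

    -- A cut inside the run leaves on the left `σ` and at most `J` maxima, a word of fertility 0 by
    -- `low′`. So only the two cuts of `cuts-σ` remain: the one after `m` gives `v`, the one before
    -- it gives `u`.
    cuts-run : ∀ {j τ δ v u} → j < suc J → Run σ j τ →
               Fert ((β ++ τ) ++ δ) v → Fert ((σ ++ τ) ++ δ) u → Cuts (σ ++ τ) δ (v + u)
    cuts-run {δ = δ} {v} {u} j<J [] fv fu = subst (λ α → Cuts α δ (v + u)) (sym (++-identityʳ σ))
      (cuts-σ (reverseView β) β<m (Fert-≡ (cong (_++ δ) (++-identityʳ β)) fv) (Fert-≡ (cong (_++ δ) (++-identityʳ σ)) fu))
    cuts-run {δ = δ} (s≤s j<J) r₁@(_▷_ {τ = τ} {m = n} r a) v u = cuts-▷-skip σ τ (low′ (s≤s j<J) r₁)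
      (cuts-run (m≤n⇒m≤1+n j<J) r (Fert-≡ (shape β) v) (Fert-≡ (shape σ) u))
      where
      shape : ∀ α → (α ++ τ ∷ʳ n) ++ δ ≡ (α ++ τ) ++ n ∷ δ
      shape α = trans (cong (_++ δ) (sym (++-assoc α τ [ n ]))) (∷ʳ-++ (α ++ τ) n δ)

  ++[] : ∀ {π f} → Fert π f → Fert (π ++ []) f
  ++[] {π} = Fert-≡ (sym (++-identityʳ π))

  at₀′ : ∀ {τ} → Run σ (1 + J) τ → Fert (σ ++ τ) x
  at₀′ (_▷_ {τ = τ} r a) = subst (Fert _) (+-identityʳ x)
    (Fert-▷ σ τ a (cuts-run ≤-refl r (++[] (at₀ (run-tail r))) (++[] (low′ ≤-refl r))))

  at₁′ : ∀ {τ} → Run σ (2 + J) τ → Fert (σ ++ τ) (2 * x + y)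
  -- The cut at the right end gives `x`, the cut after `m` gives `y`, the cut before `m` gives `x`.
  at₁′ (r₁@(_▷_ {τ = τ} {m = n} r b) ▷ a) = subst (Fert _) (eq x y) (Fert-▷ σ (τ ∷ʳ n) a
    (cuts-▷ σ τ (at₀′ r₁) Fert-[] (cuts-run ≤-refl r
      (Fert-≡ (sym (++-assoc β τ [ n ])) (at₁ (run-tail r₁)))
      (Fert-≡ (sym (++-assoc σ τ [ n ])) (at₀′ r₁)))))
    where
    eq : ∀ x y → x * 1 + (y + x) ≡ 2 * x + y
    eq = solve-∀

  push : Profile σ (suc J) x (2 * x + y)
  push = record { low = low′ ; at₀ = at₀′ ; at₁ = at₁′ }

  push₂ : ∀ {z} → Profile₂ β J z → Profile₂ σ (suc J) (5 * x + 2 * y + z)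
  -- From right to left: the cut at the end gives 2x + y, the cut before `k` gives x, those after
  -- and before `m` give z and 2x + y.
  push₂ {z} at₂ (r₂@(_▷_ {m = k} r₁@(_▷_ {τ = τ} {m = n} r c) b) ▷ a) = subst (Fert _) (eq x y z) (Fert-▷ σ (τ ∷ʳ n ∷ʳ k) a
    (cuts-▷ σ (τ ∷ʳ n) (at₁′ r₂) Fert-[] (cuts-▷ σ τ (at₀′ r₁) (Fert-singleton _) (cuts-run ≤-refl r
      (Fert-≡ (sym (shape β)) (at₂ (run-tail r₂)))
      (Fert-≡ (sym (shape σ)) (at₁′ r₂))))))
    where
    eq : ∀ x y z → (2 * x + y) * 1 + (x * 1 + (z + (2 * x + y))) ≡ 5 * x + 2 * y + z
    eq = solve-∀
    shape : ∀ {k} α → (α ++ τ) ++ n ∷ k ∷ [] ≡ α ++ (τ ∷ʳ n) ∷ʳ k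
    shape {k} α = trans (++-assoc α τ (n ∷ k ∷ [])) (cong (α ++_) (sym (++-assoc τ [ n ] [ k ])))

-- For one point Φ = C² = 1 + 2z + 5z² + ..., as increasing words have Catalan many preimages.
singleton-profile : ∀ e → Profile [ e ] 0 1 2
singleton-profile e = record
  { low = λ ()
  ; at₀ = λ { [] → Fert-singleton e }
  ; at₁ = λ { ([] ▷ a) → Fert-∷ʳ a (cuts-∷ʳ (Fert-singleton e) Fert-[] (cuts-[] (Fert-singleton e))) }
  }

singleton-profile₂ : ∀ e → Profile₂ [ e ] 0 5
singleton-profile₂ e (r@([] ▷ a) ▷ b) =
  Fert-∷ʳ b (cuts-∷ʳ {[ e ]} two Fert-[] (cuts-∷ʳ (Fert-singleton e) (Fert-singleton _) (cuts-[] two)))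
  where two = Profile.at₁ (singleton-profile e) r

-- Realisation by permutations, and the fertility numbers obtained

record Bounded (σ : List ℕ) (n : ℕ) : Set where
  constructor bounded
  field
    permutation : IsPermutation σ
    nonempty    : σ ≢ []
    bound       : All (_≤ n) σ

∷-bounded : ∀ {σ n} → Bounded σ n → Bounded (suc n ∷ σ) (suc n)
∷-bounded (bounded (a , u) _ σ≤n) = bounded
  (z<s ∷ a , All.map (λ x≤n → >⇒≢ (s≤s x≤n)) σ≤n ∷ u) (λ ()) (≤-refl ∷ All.map m≤n⇒m≤1+n σ≤n)

∷ʳ-bounded : ∀ {σ n} → Bounded σ n → Bounded (σ ∷ʳ suc n) (suc n)
∷ʳ-bounded {σ} (bounded (a , u) _ σ≤n) = bounded
  (All.∷ʳ⁺ a z<s , Unique.++⁺ u ([] ∷ []) (λ { (x∈ , here refl) → <⇒≱ ≤-refl (All.lookup σ≤n x∈) ; (_ , there ()) }))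
  (λ eq → nonempty-∷ʳ σ eq) (All.∷ʳ⁺ (All.map m≤n⇒m≤1+n σ≤n) ≤-refl)
  where
  nonempty-∷ʳ : ∀ (σ : List ℕ) {x} → σ ∷ʳ x ≢ []
  nonempty-∷ʳ []      ()
  nonempty-∷ʳ (_ ∷ _) ()

run-exists : ∀ {σ n} → Bounded σ n → ∀ j → ∃[ τ ] Run σ j τ × Bounded (σ ++ τ) (j + n)
run-exists {σ} b zero = [] , [] , subst (λ π → Bounded π _) (sym (++-identityʳ σ)) b
run-exists {σ} {n} b (suc j) with run-exists b j
... | τ , r , b′ = τ ∷ʳ suc (j + n) , r ▷ All.map s≤s (Bounded.bound b′) ,
                   subst (λ π → Bounded π _) (++-assoc σ τ _) (∷ʳ-bounded b′)

Fert⇒FertilityNumber : ∀ {π n f} → Bounded π n → Fert π f → FertilityNumber f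
Fert⇒FertilityNumber b fert = _ , Bounded.permutation b , fert (Bounded.permutation b)

profile⇒FertilityNumber : ∀ {σ n J x y} → Bounded σ n → Profile σ J x y → FertilityNumber y
profile⇒FertilityNumber {J = J} b p with run-exists b (1 + J)
... | τ , r , b′ = Fert⇒FertilityNumber b′ (Profile.at₁ p r)

Pushed : ℕ → ℕ → ℕ → Set
Pushed J x y = ∃[ σ ] ∃[ n ] Bounded σ n × Profile σ J x y

-- Pushing a - 1 maxima in front of a point gives Φ = z^(a-1) C^(2a), with coefficients 1, 2a, a (2a
-- + 3), ...
decreasing : ∀ i → let a = suc i in
             ∃[ σ ] ∃[ n ] Bounded σ n × Profile σ i 1 (2 * a) × Profile₂ σ i (a * (2 * a + 3))
decreasing zero = [ 1 ] , 1 , bounded (≤-refl ∷ [] , [] ∷ []) (λ ()) (≤-refl ∷ []) , singleton-profile 1 , singleton-profile₂ 1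
decreasing (suc i) with decreasing i
... | σ , n , b , p , p₂ = suc n ∷ σ , suc n , ∷-bounded b ,
    subst (Profile _ _ 1) (eq₁ i) P.push ,
    subst (Profile₂ _ _) (eq₂ i) (λ {τ} → P.push₂ p₂ {τ})
  where
  module P = Push (Bounded.nonempty b) (All.map s≤s (Bounded.bound b)) p
  eq₁ : ∀ i → 2 * 1 + 2 * suc i ≡ 2 * suc (suc i)
  eq₁ = solve-∀
  eq₂ : ∀ i → 5 * 1 + 2 * (2 * suc i) + suc i * (2 * suc i + 3) ≡ suc (suc i) * (2 * suc (suc i) + 3)
  eq₂ = solve-∀

-- Appending maxima drops as many initial coefficients of Φ; with J + 1 of them the second nonzero
-- position becomes the constant term.
shift-profile : ∀ {σ τ J x y z} → Run σ (1 + J) τ → Profile σ J x y → Profile₂ σ J z → Profile (σ ++ τ) 0 y z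
shift-profile {σ} {τ} r p p₂ = record
  { low = λ ()
  ; at₀ = λ { {τ′} [] → Fert-≡ (sym (++-identityʳ (σ ++ τ))) (Profile.at₁ p r) }
  ; at₁ = λ {τ′} r′ → Fert-≡ (sym (++-assoc σ τ τ′)) (p₂ (run-++ r r′))
  }

pushes : ∀ {x y} → Pushed 0 x y → ∀ c → Pushed c x (y + c * (2 * x))
pushes {x} {y} p zero = subst (Pushed 0 x) (sym (+-identityʳ y)) p
pushes {x} {y} p (suc c) with pushes p c
... | σ , n , b , q = suc n ∷ σ , suc n , ∷-bounded b , subst (Profile _ _ x) (eq x y (c * (2 * x))) P.push
  where
  module P = Push (Bounded.nonempty b) (All.map s≤s (Bounded.bound b)) q
  eq : ∀ x y k → 2 * x + (y + k) ≡ y + (2 * x + k)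
  eq = solve-∀

fertile-even : ∀ i → FertilityNumber (2 * suc i)
fertile-even i = let (_ , _ , b , p , _) = decreasing i in profile⇒FertilityNumber b p

-- After a maxima are appended, the leading coefficients are 2a and a (2a + 3). Each of `c` further
-- pushes adds 2 · 2a to the second one.
fertile-product : ∀ i c → let a = suc i in FertilityNumber (a * (2 * a + 3 + 4 * c))
fertile-product i c with decreasing i
... | σ , n , b , p , p₂ with run-exists b (1 + i)
...   | τ , r , b′ with pushes (_ , _ , b′ , shift-profile r p (λ {τ} → p₂ {τ})) c
...     | _ , _ , b″ , q = subst FertilityNumber (eq (suc i) c) (profile⇒FertilityNumber b″ q)
  where
  eq : ∀ a c → a * (2 * a + 3) + c * (2 * (2 * a)) ≡ a * (2 * a + 3 + 4 * c)
  eq = solve-∀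

-- Finite sums

∑ : ℕ → (ℕ → ℕ) → ℕ
∑ zero    f = 0
∑ (suc n) f = f 0 + ∑ n (f ∘ suc)

𝟙 : {A : Set} → Dec A → ℕ
𝟙 (yes _) = 1
𝟙 (no _)  = 0

private variable
  f g : ℕ → ℕ

𝟙-yes : (d : Dec A) → A → 𝟙 d ≡ 1
𝟙-yes (yes _) p = refl
𝟙-yes (no ¬p) p = contradiction p ¬p

𝟙-no : (d : Dec A) → ¬ A → 𝟙 d ≡ 0
𝟙-no (yes p) ¬p = contradiction p ¬p
𝟙-no (no _)  ¬p = refl

𝟙≤1 : (d : Dec A) → 𝟙 d ≤ 1
𝟙≤1 (yes _) = ≤-refl
𝟙≤1 (no _)  = z≤n

𝟙≢0 : (d : Dec A) → 𝟙 d ≢ 0 → A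
𝟙≢0 (yes p) _  = p
𝟙≢0 (no _)  ≢0 = contradiction refl ≢0

𝟙-mono : (d : Dec A) (e : Dec B) → (A → B) → 𝟙 d ≤ 𝟙 e
𝟙-mono (no _)  e h = z≤n
𝟙-mono (yes p) e h = ≤-reflexive (sym (𝟙-yes e (h p)))

𝟙-cong : (d : Dec A) (e : Dec B) → (A → B) → (B → A) → 𝟙 d ≡ 𝟙 e
𝟙-cong d e h k = ≤-antisym (𝟙-mono d e h) (𝟙-mono e d k)

*≢0ˡ : ∀ m n → m * n ≢ 0 → m ≢ 0
*≢0ˡ m n mn≢0 refl = mn≢0 refl

*≢0ʳ : ∀ m n → m * n ≢ 0 → n ≢ 0
*≢0ʳ m n mn≢0 refl = mn≢0 (*-zeroʳ m)

∑-cong : ∀ n → (∀ i → i < n → f i ≡ g i) → ∑ n f ≡ ∑ n g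
∑-cong zero    h = refl
∑-cong (suc n) h = cong₂ _+_ (h 0 z<s) (∑-cong n (λ i i<n → h (suc i) (s<s i<n)))

∑-mono : ∀ n → (∀ i → i < n → f i ≤ g i) → ∑ n f ≤ ∑ n g
∑-mono zero    h = z≤n
∑-mono (suc n) h = +-mono-≤ (h 0 z<s) (∑-mono n (λ i i<n → h (suc i) (s<s i<n)))

∑-const : ∀ n c → ∑ n (λ _ → c) ≡ n * c
∑-const zero    c = refl
∑-const (suc n) c = cong (c +_) (∑-const n c)

∑-zero : ∀ n → (∀ i → i < n → f i ≡ 0) → ∑ n f ≡ 0
∑-zero n h = trans (∑-cong n h) (trans (∑-const n 0) (*-zeroʳ n))

∑-+ : ∀ n f g → ∑ n (λ i → f i + g i) ≡ ∑ n f + ∑ n g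
∑-+ zero    f g = refl
∑-+ (suc n) f g = trans (cong (f 0 + g 0 +_) (∑-+ n (f ∘ suc) (g ∘ suc)))
                        (interchange (f 0) (g 0) _ _)
  where
  interchange : ∀ a b c d → a + b + (c + d) ≡ a + c + (b + d)
  interchange = solve-∀

∑-*ˡ : ∀ n c f → ∑ n (λ i → c * f i) ≡ c * ∑ n f
∑-*ˡ zero    c f = sym (*-zeroʳ c)
∑-*ˡ (suc n) c f = trans (cong (c * f 0 +_) (∑-*ˡ n c (f ∘ suc))) (sym (*-distribˡ-+ c (f 0) _))

∑-*ʳ : ∀ n f c → ∑ n (λ i → f i * c) ≡ ∑ n f * c
∑-*ʳ n f c = trans (∑-cong n (λ i _ → *-comm (f i) c)) (trans (∑-*ˡ n c f) (*-comm c _))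

∑-swap : ∀ m n (h : ℕ → ℕ → ℕ) → ∑ m (λ i → ∑ n (h i)) ≡ ∑ n (λ j → ∑ m (λ i → h i j))
∑-swap zero    n h = sym (∑-zero n (λ _ _ → refl))
∑-swap (suc m) n h = trans (cong (∑ n (h 0) +_) (∑-swap m n (h ∘ suc)))
                           (sym (∑-+ n (h 0) _))

∑-split : ∀ m n f → ∑ (m + n) f ≡ ∑ m f + ∑ n (λ i → f (m + i))
∑-split zero    n f = refl
∑-split (suc m) n f = trans (cong (f 0 +_) (∑-split m n (f ∘ suc))) (sym (+-assoc (f 0) _ _))

∑-≤ : ∀ {m n} f → m ≤ n → ∑ m f ≤ ∑ n f
∑-≤ {m} {n} f m≤n = subst (λ k → ∑ m f ≤ ∑ k f) (m+[n∸m]≡n m≤n)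
  (≤-trans (m≤m+n _ _) (≤-reflexive (sym (∑-split m (n ∸ m) f))))

term≤∑ : ∀ {n i} f → i < n → f i ≤ ∑ n f
term≤∑ {suc n} {zero}  f _         = m≤m+n _ _
term≤∑ {suc n} {suc i} f (s≤s i<n) = ≤-trans (term≤∑ (f ∘ suc) i<n) (m≤n+m _ _)

∑≢0⇒∃ : ∀ n → ∑ n f ≢ 0 → ∃[ i ] i < n × f i ≢ 0
∑≢0⇒∃ zero    ≢0 = contradiction refl ≢0
∑≢0⇒∃ {f} (suc n) ≢0 with f 0 ≟ 0
... | no  f0≢0 = 0 , z<s , f0≢0
... | yes f0≡0 with ∑≢0⇒∃ n (λ eq → ≢0 (cong₂ _+_ f0≡0 eq))
...   | i , i<n , fi≢0 = suc i , s<s i<n , fi≢0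

∑-≤1 : ∀ n → (∀ i → i < n → f i ≤ 1) →
       (∀ i j → i < n → j < n → f i ≢ 0 → f j ≢ 0 → i ≡ j) → ∑ n f ≤ 1
∑-≤1 zero    h u = z≤n
∑-≤1 {f} (suc n) h u with f 0 ≟ 0
... | yes f0≡0 rewrite f0≡0 =
  ∑-≤1 n (λ i i<n → h (suc i) (s<s i<n))
         (λ i j i<n j<n p q → suc-injective (u (suc i) (suc j) (s<s i<n) (s<s j<n) p q))
... | no  f0≢0 = begin
  f 0 + ∑ n (f ∘ suc) ≡⟨ cong (f 0 +_) (∑-zero n rest) ⟩
  f 0 + 0             ≡⟨ +-identityʳ _ ⟩
  f 0                 ≤⟨ h 0 z<s ⟩
  1                   ∎
  where
  open ≤-Reasoning
  rest : ∀ i → i < n → f (suc i) ≡ 0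
  rest i i<n with f (suc i) ≟ 0
  ... | yes eq = eq
  ... | no  ne = contradiction (u 0 (suc i) z<s (s<s i<n) f0≢0 ne) λ ()

∑-δ : ∀ {n k} (f : ℕ → ℕ) → k < n → ∑ n (λ i → 𝟙 (k ≟ i) * f i) ≡ f k
∑-δ {suc n} {zero} f _ = trans (cong₂ _+_ (+-identityʳ (f 0))
  (∑-zero n λ i _ → cong (_* f (suc i)) (𝟙-no (0 ≟ suc i) λ ()))) (+-identityʳ _)
∑-δ {suc n} {suc k} f (s≤s k<n) = trans
  (∑-cong n (λ i _ → cong (_* f (suc i)) (𝟙-cong (suc k ≟ suc i) (k ≟ i) suc-injective (cong suc))))
  (∑-δ (f ∘ suc) k<n)

∑-δ-out : ∀ {n k} (f : ℕ → ℕ) → n ≤ k → ∑ n (λ i → 𝟙 (k ≟ i) * f i) ≡ 0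
∑-δ-out {n} {k} f n≤k = ∑-zero n λ i i<n →
  cong (_* f i) (𝟙-no (k ≟ i) λ { refl → <⇒≱ i<n n≤k })

∑-δ-total : ∀ N k (f : ℕ → ℕ) → (∀ j → N ≤ j → f j ≡ 0) → f k ≡ ∑ N (λ j → 𝟙 (k ≟ j) * f j)
∑-δ-total N k f out with k <? N
... | yes k<N = sym (∑-δ f k<N)
... | no  k≮N = trans (out k (≮⇒≥ k≮N)) (sym (∑-δ-out f (≮⇒≥ k≮N)))

∑-fibres : ∀ m N (a f : ℕ → ℕ) → (∀ k → N ≤ k → f k ≡ 0) →
           ∑ m (λ i → f (a i)) ≡ ∑ N (λ k → ∑ m (λ i → 𝟙 (a i ≟ k)) * f k)
∑-fibres m N a f out = begin
  ∑ m (λ i → f (a i))                               ≡⟨ ∑-cong m (λ i _ → ∑-δ-total N (a i) f out) ⟩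
  ∑ m (λ i → ∑ N (λ k → 𝟙 (a i ≟ k) * f k))         ≡⟨ ∑-swap m N _ ⟩
  ∑ N (λ k → ∑ m (λ i → 𝟙 (a i ≟ k) * f k))         ≡⟨ ∑-cong N (λ k _ → ∑-*ʳ m _ (f k)) ⟩
  ∑ N (λ k → ∑ m (λ i → 𝟙 (a i ≟ k)) * f k)         ∎
  where open ≡-Reasoning

-- Collects the terms of a double sum by the value of `a i j`, later always a product. The range of
-- `j` may depend on `i`, as `β-count` requires.
∑∑-fibres : ∀ m (n : ℕ → ℕ) N (a c : ℕ → ℕ → ℕ) (f : ℕ → ℕ) → (∀ k → N ≤ k → f k ≡ 0) →
            ∑ m (λ i → ∑ (n i) (λ j → c i j * f (a i j))) ≡
            ∑ N (λ k → ∑ m (λ i → ∑ (n i) (λ j → 𝟙 (a i j ≟ k) * c i j)) * f k)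
∑∑-fibres m n N a c f out = begin
  ∑ m (λ i → ∑ (n i) (λ j → c i j * f (a i j)))
    ≡⟨ ∑-cong m (λ i _ → ∑-cong (n i) (λ j _ → eq i j)) ⟩
  ∑ m (λ i → ∑ (n i) (λ j → ∑ N (λ k → 𝟙 (a i j ≟ k) * c i j * f k)))
    ≡⟨ ∑-cong m (λ i _ → ∑-swap (n i) N _) ⟩
  ∑ m (λ i → ∑ N (λ k → ∑ (n i) (λ j → 𝟙 (a i j ≟ k) * c i j * f k)))
    ≡⟨ ∑-swap m N _ ⟩
  ∑ N (λ k → ∑ m (λ i → ∑ (n i) (λ j → 𝟙 (a i j ≟ k) * c i j * f k)))
    ≡⟨ ∑-cong N (λ k _ → trans (∑-cong m (λ i _ → ∑-*ʳ (n i) _ (f k))) (∑-*ʳ m _ (f k))) ⟩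
  ∑ N (λ k → ∑ m (λ i → ∑ (n i) (λ j → 𝟙 (a i j ≟ k) * c i j)) * f k) ∎
  where
  open ≡-Reasoning
  rearrange : ∀ x y z → y * (x * z) ≡ x * y * z
  rearrange = solve-∀
  eq : ∀ i j → c i j * f (a i j) ≡ ∑ N (λ k → 𝟙 (a i j ≟ k) * c i j * f k)
  eq i j = trans (cong (c i j *_) (∑-δ-total N (a i j) f out)) (trans (sym (∑-*ˡ N (c i j) _))
             (∑-cong N λ k _ → rearrange (𝟙 (a i j ≟ k)) (c i j) (f k)))

∑*∑ : ∀ m n f g → ∑ m f * ∑ n g ≡ ∑ m (λ i → ∑ n (λ j → f i * g j))
∑*∑ m n f g = trans (sym (∑-*ʳ m f (∑ n g))) (∑-cong m λ i _ → sym (∑-*ˡ n (f i) g))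

-- Divisors modulo 4

primeDivisor : ∀ {n} → 1 < n → ∃[ p ] Prime p × p ∣ n
primeDivisor {n} 1<n with factorise n {{>-nonZero (<-trans z<s 1<n)}}
... | record { factors = []     ; isFactorisation = refl } = contradiction 1<n λ { (s≤s ()) }
... | record { factors = p ∷ ps ; isFactorisation = refl ; factorsPrime = pp ∷ _ } =
  p , pp , m∣m*n (product ps)

prime>0 : ∀ {p} → Prime p → 0 < p
prime>0 pp = >-nonZero⁻¹ _ {{prime⇒nonZero pp}}

prime∤⇒coprime : ∀ {p d} → Prime p → ¬ p ∣ d → Coprime d p
prime∤⇒coprime pp p∤d (i∣d , i∣p) with prime⇒irreducible pp i∣p
... | inj₁ refl = refl
... | inj₂ refl = contradiction i∣d p∤d

prime∣prime : ∀ {p q} → Prime p → Prime q → p ∣ q → p ≡ q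
prime∣prime pp pq p∣q with prime⇒irreducible pq p∣q
... | inj₁ refl = contradiction pp ¬prime[1]
... | inj₂ eq   = eq

∤⇒∣* : ∀ {p d n} → Prime p → ¬ p ∣ d → d ∣ p * n → d ∣ n
∤⇒∣* pp p∤d = coprime-divisor (prime∤⇒coprime pp p∤d)

cofactor<  : ∀ {p k} → Prime p → 0 < p * k → k < p * k
cofactor< {p} {k} pp pk>0 =
  subst (_< p * k) (*-identityˡ k)
    (*-monoˡ-< k {{≢-nonZero λ { refl → <⇒≢ pk>0 (sym (*-zeroʳ p)) }}} (nonTrivial⇒n>1 p {{prime⇒nonTrivial pp}}))

factor>0ʳ : ∀ m n → 0 < m * n → 0 < n
factor>0ʳ m n 0<mn = n≢0⇒n>0 (*≢0ʳ m n (>⇒≢ 0<mn))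

factor>0ˡ : ∀ m n → 0 < m * n → 0 < m
factor>0ˡ m n 0<mn = n≢0⇒n>0 (*≢0ˡ m n (>⇒≢ 0<mn))

residue-cases : ∀ (P : ℕ → Set) → P 0 → P 1 → P 2 → P 3 → ∀ n → P (n % 4)
residue-cases P p₀ p₁ p₂ p₃ n with n % 4 | m%n<n n 4
... | 0 | _ = p₀
... | 1 | _ = p₁
... | 2 | _ = p₂
... | 3 | _ = p₃
... | suc (suc (suc (suc _))) | s≤s (s≤s (s≤s (s≤s ())))

*-%4 : ∀ {a b} m n → m % 4 ≡ a → n % 4 ≡ b → (m * n) % 4 ≡ (a * b) % 4
*-%4 m n refl refl = %-distribˡ-* m n 4

3*-%4 : ∀ p d → p % 4 ≡ 3 → (p * d) % 4 ≡ (3 * (d % 4)) % 4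
3*-%4 p d p≡3 = *-%4 p d p≡3 refl

even⇒2 : ∀ {p} → Prime p → p % 4 ≢ 1 → p % 4 ≢ 3 → p ≡ 2
even⇒2 {p} pp ≢1 ≢3 with m%n≡0⇒n∣m p 2 (residue-cases₂ p ≢1 ≢3)
  where
  residue-cases₂ : ∀ p → p % 4 ≢ 1 → p % 4 ≢ 3 → p % 2 ≡ 0
  residue-cases₂ 0 _ _ = refl
  residue-cases₂ 1 ≢1 _ = contradiction refl ≢1
  residue-cases₂ 2 _ _ = refl
  residue-cases₂ 3 _ ≢3 = contradiction refl ≢3
  residue-cases₂ (suc (suc (suc (suc p)))) ≢1 ≢3 = residue-cases₂ p ≢1 ≢3
... | 2∣p with prime⇒irreducible pp 2∣p
...   | inj₂ eq = sym eq

1mod4-closed : ∀ n → 0 < n → (∀ {p} → Prime p → p ∣ n → p % 4 ≡ 1) → n % 4 ≡ 1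
1mod4-closed = <-rec _ step
  where
  step : ∀ n → (∀ {k} → k < n → 0 < k → (∀ {p} → Prime p → p ∣ k → p % 4 ≡ 1) → k % 4 ≡ 1) →
         0 < n → (∀ {p} → Prime p → p ∣ n → p % 4 ≡ 1) → n % 4 ≡ 1
  step 1 rec 0<n h = refl
  step n@(suc (suc _)) rec 0<n h with primeDivisor {n} (s<s z<s)
  ... | p , pp , divides k eq = trans (cong (_% 4) eq′)
      (*-%4 p k (h pp (divides k eq))
        (rec (subst (k <_) (sym eq′) (cofactor< pp 0<pk)) (factor>0ʳ p k 0<pk)
             (λ pq q∣k → h pq (∣-trans q∣k (divides p eq′)))))
    where
    eq′ : n ≡ p * k
    eq′ = trans eq (*-comm k p)
    0<pk : 0 < p * k
    0<pk = subst (0 <_) eq′ 0<n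

divisor-1mod4 : ∀ {n d} → 0 < n → (∀ {p} → Prime p → p ∣ n → p % 4 ≡ 1) → d ∣ n → d % 4 ≡ 1
divisor-1mod4 {d = d} 0<n one d∣n = 1mod4-closed d (n≢0⇒n>0 λ { refl → <⇒≢ 0<n (sym (0∣⇒≡0 d∣n)) })
                                      (λ pp p∣d → one pp (∣-trans p∣d d∣n))

∑-hits : ∀ {Z p k} → 0 < p → k < Z → ∑ Z (λ e → 𝟙 (p * e ≟ k)) ≡ 𝟙 (p ∣? k)
∑-hits {Z} {p} {k} 0<p k<Z with p ∣? k
... | no  p∤k = ∑-zero Z λ e _ → 𝟙-no (p * e ≟ k) λ { refl → p∤k (m∣m*n e) }
... | yes (divides q refl) = trans
  (∑-cong Z λ e _ → trans (𝟙-cong (p * e ≟ q * p) (q ≟ e)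
     (λ eq → sym (*-cancelˡ-≡ e q p {{>-nonZero 0<p}} (trans eq (*-comm q p)))) (λ { refl → *-comm p q })) (sym (*-identityʳ _)))
  (∑-δ (λ _ → 1) (≤-<-trans (m≤m*n q p {{>-nonZero 0<p}}) k<Z))

-- The substitution d = p e. Since `g` vanishes from `Z` on, both sums can keep the range `Z`.
∑-multiples : ∀ {p} Z g → 0 < p → (∀ d → Z ≤ d → g d ≡ 0) →
              ∑ Z (λ e → g (p * e)) ≡ ∑ Z (λ d → 𝟙 (p ∣? d) * g d)
∑-multiples {p} Z g 0<p out =
  trans (∑-fibres Z Z (p *_) g out)
        (∑-cong Z λ d d<Z → cong (_* g d) (∑-hits 0<p d<Z))

-- The divisors of n are counted below a fixed Z > n, so that divs ρ Z n and
-- divs ρ Z (p * n) are sums over the same range.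
divs : ℕ → ℕ → ℕ → ℕ
divs ρ Z n = ∑ Z λ d → 𝟙 (d % 4 ≟ ρ) * 𝟙 (d ∣? n)

-- The part of `divs` that a further prime factor `p` of `n` does not change (`divs∤-*p`).
divs∤ : ℕ → ℕ → ℕ → ℕ → ℕ
divs∤ p ρ Z n = ∑ Z λ d → 𝟙 (¬? (p ∣? d)) * (𝟙 (d % 4 ≟ ρ) * 𝟙 (d ∣? n))

module _ {p : ℕ} (pp : Prime p) where

  -- A divisor of p n is either not divisible by p, or p e with e a divisor of n; the last two
  -- hypotheses translate the residue of p e into that of e.
  divs-*p : ∀ {ρ ρ′ Z n} → 0 < n → p * n < Z →
            (∀ e → (p * e) % 4 ≡ ρ → e % 4 ≡ ρ′) → (∀ e → e % 4 ≡ ρ′ → (p * e) % 4 ≡ ρ) →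
            divs ρ Z (p * n) ≡ divs∤ p ρ Z (p * n) + divs ρ′ Z n
  divs-*p {ρ} {ρ′} {Z} {n} 0<n pn<Z to from = begin
    ∑ Z term
      ≡⟨ ∑-cong Z (λ d _ → split (p ∣? d) (term d)) ⟩
    ∑ Z (λ d → 𝟙 (¬? (p ∣? d)) * term d + 𝟙 (p ∣? d) * term d)
      ≡⟨ ∑-+ Z _ _ ⟩
    divs∤ p ρ Z (p * n) + ∑ Z (λ d → 𝟙 (p ∣? d) * term d)
      ≡⟨ cong (divs∤ p ρ Z (p * n) +_) (∑-multiples Z term (prime>0 pp) out) ⟨
    divs∤ p ρ Z (p * n) + ∑ Z (λ e → term (p * e))
      ≡⟨ cong (divs∤ p ρ Z (p * n) +_) (∑-cong Z λ e _ →
           cong₂ _*_ (𝟙-cong ((p * e) % 4 ≟ ρ) (e % 4 ≟ ρ′) (to e) (from e))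
                     (𝟙-cong (p * e ∣? p * n) (e ∣? n) (*-cancelˡ-∣ p {{prime⇒nonZero pp}}) (*-monoʳ-∣ p))) ⟩
    divs∤ p ρ Z (p * n) + divs ρ′ Z n ∎
    where
    open ≡-Reasoning
    term : ℕ → ℕ
    term d = 𝟙 (d % 4 ≟ ρ) * 𝟙 (d ∣? p * n)
    split : {P : Set} (d : Dec P) (x : ℕ) → x ≡ 𝟙 (¬? d) * x + 𝟙 d * x
    split (yes _) x = sym (+-identityʳ x)
    split (no _)  x = sym (trans (+-identityʳ _) (+-identityʳ x))
    out : ∀ d → Z ≤ d → term d ≡ 0
    out d Z≤d = trans (cong (𝟙 (d % 4 ≟ ρ) *_) (𝟙-no (d ∣? p * n)
      (λ d∣ → <⇒≱ pn<Z (≤-trans Z≤d (∣⇒≤ {{m*n≢0 p n {{prime⇒nonZero pp}} {{>-nonZero 0<n}}}} d∣)))))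
      (*-zeroʳ (𝟙 (d % 4 ≟ ρ)))

  divs∤-*p : ∀ ρ Z n → divs∤ p ρ Z (p * n) ≡ divs∤ p ρ Z n
  divs∤-*p ρ Z n = ∑-cong Z λ d _ → eq d (p ∣? d)
    where
    eq : ∀ d (p∣?d : Dec (p ∣ d)) → 𝟙 (¬? p∣?d) * (𝟙 (d % 4 ≟ ρ) * 𝟙 (d ∣? p * n))
                                 ≡ 𝟙 (¬? p∣?d) * (𝟙 (d % 4 ≟ ρ) * 𝟙 (d ∣? n))
    eq d (yes _)  = refl
    eq d (no p∤d) = cong (λ x → 1 * (𝟙 (d % 4 ≟ ρ) * x))
      (𝟙-cong (d ∣? p * n) (d ∣? n) (∤⇒∣* pp p∤d) (∣n⇒∣m*n p))

  divs∤-∤ : ∀ ρ Z n → ¬ p ∣ n → divs∤ p ρ Z n ≡ divs ρ Z n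
  divs∤-∤ ρ Z n p∤n = ∑-cong Z λ d _ → eq d (p ∣? d)
    where
    eq : ∀ d (p∣?d : Dec (p ∣ d)) → 𝟙 (¬? p∣?d) * (𝟙 (d % 4 ≟ ρ) * 𝟙 (d ∣? n))
                                 ≡ 𝟙 (d % 4 ≟ ρ) * 𝟙 (d ∣? n)
    eq d (no p∤d)  = *-identityˡ _
    eq d (yes p∣d) = sym (trans (cong (𝟙 (d % 4 ≟ ρ) *_) (𝟙-no (d ∣? n) (p∤n ∘ ∣-trans p∣d)))
                                (*-zeroʳ (𝟙 (d % 4 ≟ ρ))))

  module _ (p≡3 : p % 4 ≡ 3) where

    private
      31→ : ∀ e → (p * e) % 4 ≡ 1 → e % 4 ≡ 3
      31→ e eq = residue-cases (λ r → (3 * r) % 4 ≡ 1 → r ≡ 3) (λ ()) (λ ()) (λ ()) (λ _ → refl) e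
                   (trans (sym (3*-%4 p e p≡3)) eq)
      31← : ∀ e → e % 4 ≡ 3 → (p * e) % 4 ≡ 1
      31← e eq = *-%4 p e p≡3 eq
      33→ : ∀ e → (p * e) % 4 ≡ 3 → e % 4 ≡ 1
      33→ e eq = residue-cases (λ r → (3 * r) % 4 ≡ 3 → r ≡ 1) (λ ()) (λ _ → refl) (λ ()) (λ ()) e
                   (trans (sym (3*-%4 p e p≡3)) eq)
      33← : ∀ e → e % 4 ≡ 1 → (p * e) % 4 ≡ 3
      33← e eq = *-%4 p e p≡3 eq

    divs₁-3 : ∀ {Z n} → 0 < n → p * n < Z → divs 1 Z (p * n) ≡ divs∤ p 1 Z n + divs 3 Z n
    divs₁-3 {Z} {n} 0<n lt = trans (divs-*p 0<n lt 31→ 31←) (cong (_+ divs 3 Z n) (divs∤-*p 1 Z n))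

    divs₃-3 : ∀ {Z n} → 0 < n → p * n < Z → divs 3 Z (p * n) ≡ divs∤ p 3 Z n + divs 1 Z n
    divs₃-3 {Z} {n} 0<n lt = trans (divs-*p 0<n lt 33→ 33←) (cong (_+ divs 1 Z n) (divs∤-*p 3 Z n))

divs-2* : ∀ ρ Z n → (∀ d → d % 4 ≡ ρ → ¬ 2 ∣ d) → divs ρ Z (2 * n) ≡ divs ρ Z n
divs-2* ρ Z n odd = ∑-cong Z λ d _ → eq d (d % 4 ≟ ρ)
  where
  eq : ∀ d (dec : Dec (d % 4 ≡ ρ)) → 𝟙 dec * 𝟙 (d ∣? 2 * n) ≡ 𝟙 dec * 𝟙 (d ∣? n)
  eq d (no _)  = refl
  eq d (yes e) = cong (1 *_) (𝟙-cong (d ∣? 2 * n) (d ∣? n)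
                   (∤⇒∣* prime[2] (odd d e)) (∣n⇒∣m*n 2))

odd-residue : ∀ d → 2 ∣ d → d % 4 ≢ 1 × d % 4 ≢ 3
odd-residue d (divides q refl) rewrite *-comm q 2 | *-%4 2 q refl refl =
  residue-cases (λ r → (2 * r) % 4 ≢ 1 × (2 * r) % 4 ≢ 3)
    ((λ ()) , λ ()) ((λ ()) , λ ()) ((λ ()) , λ ()) ((λ ()) , λ ()) q

divs₃≡0 : ∀ Z {n} → 0 < n → (∀ {p} → Prime p → p ∣ n → p % 4 ≡ 1) → divs 3 Z n ≡ 0
divs₃≡0 Z {n} 0<n one = ∑-zero Z λ d _ → none d
  where
  none : ∀ d → 𝟙 (d % 4 ≟ 3) * 𝟙 (d ∣? n) ≡ 0
  none d with d ∣? n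
  ... | no _    = *-zeroʳ (𝟙 (d % 4 ≟ 3))
  ... | yes d∣n = cong (_* 1) (𝟙-no (d % 4 ≟ 3) λ d≡3 →
                    contradiction (trans (sym d≡3) (divisor-1mod4 0<n one d∣n)) λ ())

-- With r = divs 1 - divs 3, a prime p ≡ 3 mod 4 gives r (p² j) = r j, and
-- r (p k) = 0 if p ∤ k; also r (2 k) = r k.
divs₃≤divs₁ : ∀ {Z} n → 0 < n → n < Z → divs 3 Z n ≤ divs 1 Z n
divs₃≤divs₁ {Z} = <-rec _ step
  where
  open ≤-Reasoning

  Below : ℕ → Set
  Below n = ∀ {k} → k < n → 0 < k → k < Z → divs 3 Z k ≤ divs 1 Z k

  swap₁ : ∀ a b c → a + (b + c) ≡ b + (a + c)
  swap₁ = solve-∀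

  simple : ∀ {p} k → Prime p → p % 4 ≡ 3 → ¬ p ∣ k → 0 < p * k → p * k < Z →
           divs 3 Z (p * k) ≤ divs 1 Z (p * k)
  simple {p} k pp ≡3 p∤k 0<n n<Z = begin
    divs 3 Z (p * k)              ≡⟨ divs₃-3 pp ≡3 0<k n<Z ⟩
    divs∤ p 3 Z k + divs 1 Z k    ≡⟨ cong (_+ divs 1 Z k) (divs∤-∤ pp 3 Z k p∤k) ⟩
    divs 3 Z k + divs 1 Z k       ≡⟨ +-comm (divs 3 Z k) _ ⟩
    divs 1 Z k + divs 3 Z k       ≡⟨ cong (_+ divs 3 Z k) (divs∤-∤ pp 1 Z k p∤k) ⟨
    divs∤ p 1 Z k + divs 3 Z k    ≡⟨ divs₁-3 pp ≡3 0<k n<Z ⟨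
    divs 1 Z (p * k)              ∎
    where 0<k = factor>0ʳ p k 0<n

  square : ∀ {p} j → Prime p → p % 4 ≡ 3 → Below (p * (p * j)) → 0 < p * (p * j) → p * (p * j) < Z →
           divs 3 Z (p * (p * j)) ≤ divs 1 Z (p * (p * j))
  square {p} j pp ≡3 rec 0<n n<Z = begin
    divs 3 Z (p * (p * j))                              ≡⟨ divs₃-3 pp ≡3 0<k n<Z ⟩
    divs∤ p 3 Z (p * j) + divs 1 Z (p * j)              ≡⟨ cong₂ _+_ (divs∤-*p pp 3 Z j) (divs₁-3 pp ≡3 0<j k<Z) ⟩
    divs∤ p 3 Z j + (divs∤ p 1 Z j + divs 3 Z j)        ≤⟨ +-monoʳ-≤ (divs∤ p 3 Z j) (+-monoʳ-≤ (divs∤ p 1 Z j)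
                                                             (rec (<-trans j<k k<n) 0<j (<-trans j<k k<Z))) ⟩
    divs∤ p 3 Z j + (divs∤ p 1 Z j + divs 1 Z j)        ≡⟨ swap₁ (divs∤ p 3 Z j) (divs∤ p 1 Z j) _ ⟩
    divs∤ p 1 Z j + (divs∤ p 3 Z j + divs 1 Z j)        ≡⟨ cong₂ _+_ (divs∤-*p pp 1 Z j) (divs₃-3 pp ≡3 0<j k<Z) ⟨
    divs∤ p 1 Z (p * j) + divs 3 Z (p * j)              ≡⟨ divs₁-3 pp ≡3 0<k n<Z ⟨
    divs 1 Z (p * (p * j))                              ∎
    where
    0<k = factor>0ʳ p (p * j) 0<n
    0<j = factor>0ʳ p j 0<k
    j<k = cofactor< {p} {j} pp 0<k
    k<n = cofactor< {p} {p * j} pp 0<n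
    k<Z = <-trans k<n n<Z

  at-prime : ∀ p k → Prime p → p % 4 ≢ 1 → Below (p * k) → 0 < p * k → p * k < Z →
             divs 3 Z (p * k) ≤ divs 1 Z (p * k)
  at-prime p k pp ≢1 rec 0<n n<Z with p % 4 ≟ 3
  at-prime p k pp ≢1 rec 0<n n<Z | no ≢3 with even⇒2 pp ≢1 ≢3
  ... | refl = subst₂ _≤_ (sym (divs-2* 3 Z k λ d d≡3 2∣d → proj₂ (odd-residue d 2∣d) d≡3))
                          (sym (divs-2* 1 Z k λ d d≡1 2∣d → proj₁ (odd-residue d 2∣d) d≡1))
                          (rec k<n (factor>0ʳ p k 0<n) (<-trans k<n n<Z))
    where k<n = cofactor< {p} {k} pp 0<n
  at-prime p k pp ≢1 rec 0<n n<Z | yes ≡3 with p ∣? k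
  ... | no p∤k = simple k pp ≡3 p∤k 0<n n<Z
  ... | yes (divides j refl) rewrite *-comm j p = square j pp ≡3 rec 0<n n<Z

  step : ∀ n → Below n → 0 < n → n < Z → divs 3 Z n ≤ divs 1 Z n
  -- The search goes up to and including `n`, which may itself be the prime.
  step n rec 0<n n<Z with anyUpTo? (λ p → (prime? p ×-dec (p ∣? n)) ×-dec ¬? (p % 4 ≟ 1)) (suc n)
  ... | yes (p , _ , (pp , divides k refl) , ≢1) rewrite *-comm k p = at-prime p k pp ≢1 rec 0<n n<Z
  ... | no ¬p = ≤-trans (≤-reflexive (divs₃≡0 Z 0<n one)) z≤n
    where
    one : ∀ {p} → Prime p → p ∣ n → p % 4 ≡ 1
    one {p} pp p∣n with p % 4 ≟ 1
    ... | yes eq = eq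
    ... | no ≢1  = contradiction (p , s≤s (∣⇒≤ {{>-nonZero 0<n}} p∣n) , (pp , p∣n) , ≢1) ¬p

-- Integers whose small prime factors are 1 mod 4

-- Only primes below `M` are tested, which makes `Good M` periodic modulo `M !`; for 0 < n < M every
-- prime factor of n is tested.
Good Bad : ℕ → ℕ → Set
Good M n = ∀ {p} → p < M → Prime p → p ∣ n → p % 4 ≡ 1
Bad  M n = ∀ {p} → p < M → Prime p → p ∣ n → p % 4 ≢ 1

good? : ∀ M n → Dec (Good M n)
good? M n = allUpTo? (λ p → prime? p →-dec ((p ∣? n) →-dec (p % 4 ≟ 1))) M

bad? : ∀ M n → Dec (Bad M n)
bad? M n = allUpTo? (λ p → prime? p →-dec ((p ∣? n) →-dec ¬? (p % 4 ≟ 1))) M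

good bad : ℕ → ℕ → ℕ
good M n = 𝟙 (good? M n)
bad  M n = 𝟙 (bad? M n)

prime∤1 : ∀ {p} → Prime p → ¬ p ∣ 1
prime∤1 pp p∣1 with ∣1⇒≡1 p∣1
... | refl = ¬prime[1] pp

-- Split off one prime at a time and hand it to `t` or to `u` according to its residue modulo 4.
good×bad : ∀ M n → 0 < n → ∃[ t ] ∃[ u ] t * u ≡ n × Good M t × Bad M u
good×bad M = <-rec _ step
  where
  step : ∀ n → (∀ {k} → k < n → 0 < k → ∃[ t ] ∃[ u ] t * u ≡ k × Good M t × Bad M u) →
         0 < n → ∃[ t ] ∃[ u ] t * u ≡ n × Good M t × Bad M u
  step 1 rec 0<n = 1 , 1 , refl , (λ _ pp p∣1 → contradiction p∣1 (prime∤1 pp))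
                                , (λ _ pp p∣1 → contradiction p∣1 (prime∤1 pp))
  step n@(suc (suc _)) rec 0<n with primeDivisor {n} (s<s z<s)
  ... | p , pp , divides k eq with rec (subst (k <_) (sym n≡pk) (cofactor< pp 0<pk)) (factor>0ʳ p k 0<pk) | p % 4 ≟ 1
    where
    n≡pk : n ≡ p * k
    n≡pk = trans eq (*-comm k p)
    0<pk : 0 < p * k
    0<pk = subst (0 <_) n≡pk 0<n
  ... | t , u , refl , gt , bu | yes ≡1 = p * t , u , trans (*-assoc p t u) (trans (*-comm p (t * u)) (sym eq)) , gpt , bu
    where
    gpt : Good M (p * t)
    gpt q<M pq q∣pt with euclidsLemma p t pq q∣pt
    ... | inj₁ q∣p rewrite prime∣prime pq pp q∣p = ≡1
    ... | inj₂ q∣t = gt q<M pq q∣t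
  ... | t , u , refl , gt , bu | no ≢1 = t , p * u , trans (rearrange t p u) (sym eq) , gt , bpu
    where
    rearrange : ∀ t p u → t * (p * u) ≡ t * u * p
    rearrange = solve-∀
    bpu : Bad M (p * u)
    bpu q<M pq q∣pu with euclidsLemma p u pq q∣pu
    ... | inj₁ q∣p rewrite prime∣prime pq pp q∣p = ≢1
    ... | inj₂ q∣u = bu q<M pq q∣u

-- This is g 1 - g 3 + g 5 - ... ≤ g 1, written without subtraction. Four indices are removed at a
-- time: the rest exceeds its negative part by at most g 5, and g 5 ≤ g 3.
alternating-sum : ∀ n (g : ℕ → ℕ) → (∀ {i j} → 0 < i → i ≤ j → g j ≤ g i) →
              ∑ n (λ d → 𝟙 (d % 4 ≟ 1) * g d) ≤ g 1 + ∑ n (λ d → 𝟙 (d % 4 ≟ 3) * g d)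
alternating-sum 0 g anti = z≤n
alternating-sum 1 g anti = z≤n
alternating-sum 2 g anti = ≤-reflexive (+-assoc (g 1) 0 0)
alternating-sum 3 g anti = ≤-reflexive (+-assoc (g 1) 0 0)
alternating-sum (suc (suc (suc (suc n)))) g anti = begin
  g 1 + 0 + S₁        ≡⟨ cong (_+ S₁) (+-identityʳ (g 1)) ⟩
  g 1 + S₁            ≤⟨ +-monoʳ-≤ (g 1) (alternating-sum n (λ d → g (4 + d)) λ {_} {_} _ i≤j → anti z<s (+-monoʳ-≤ 4 i≤j)) ⟩
  g 1 + (g 5 + S₃)    ≤⟨ +-monoʳ-≤ (g 1) (+-monoˡ-≤ S₃ (anti z<s (s≤s (s≤s (s≤s z≤n))))) ⟩
  g 1 + (g 3 + S₃)    ≡⟨ cong (λ x → g 1 + (x + S₃)) (+-identityʳ (g 3)) ⟨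
  g 1 + (g 3 + 0 + S₃) ∎
  where
  open ≤-Reasoning
  S₁ = ∑ n (λ d → 𝟙 (d % 4 ≟ 1) * g (4 + d))
  S₃ = ∑ n (λ d → 𝟙 (d % 4 ≟ 3) * g (4 + d))

-- w n stands for K / n, cut off at M²: clearing denominators keeps all sums in ℕ.
module Weighted (M K : ℕ) (3≤M : 3 ≤ M) (0<K : 0 < K) (w : ℕ → ℕ)
  (w-zero : w 0 ≡ 0) (w-out : ∀ n → M * M ≤ n → w n ≡ 0) (w-eq : ∀ {n} → 0 < n → n < M * M → n * w n ≡ K)
  where

  X : ℕ
  X = M * M

  0<M : 0 < M
  0<M = <-trans z<s 3≤M

  M≤X : M ≤ X
  M≤X = m≤m*n M M {{>-nonZero 0<M}}

  w-anti : ∀ {m n} → 0 < m → m ≤ n → w n ≤ w m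
  w-anti {m} {n} 0<m m≤n with n <? X
  ... | no ≮    = ≤-trans (≤-reflexive (w-out n (≮⇒≥ ≮))) z≤n
  ... | yes n<X = *-cancelˡ-≤ m {{>-nonZero 0<m}} (begin
    m * w n ≤⟨ *-monoˡ-≤ (w n) m≤n ⟩
    n * w n ≡⟨ w-eq (<-≤-trans 0<m m≤n) n<X ⟩
    K       ≡⟨ w-eq 0<m (≤-<-trans m≤n n<X) ⟨
    m * w m ∎)
    where open ≤-Reasoning

  w-* : ∀ a b → a * b < X → w a * w b ≡ K * w (a * b)
  w-* zero b _ rewrite w-zero = sym (*-zeroʳ K)
  w-* a@(suc _) zero _ rewrite *-zeroʳ a | w-zero = trans (*-zeroʳ (w a)) (sym (*-zeroʳ K))
  w-* a@(suc _) b@(suc _) ab<X = *-cancelˡ-≡ _ _ (a * b) (begin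
    a * b * (w a * w b)   ≡⟨ r₁ a b (w a) (w b) ⟩
    (a * w a) * (b * w b) ≡⟨ cong₂ _*_ (w-eq z<s (≤-<-trans (m≤m*n a b) ab<X)) (w-eq z<s (≤-<-trans (m≤n*m b a) ab<X)) ⟩
    K * K                 ≡⟨ cong (K *_) (w-eq z<s ab<X) ⟨
    K * (a * b * w (a * b)) ≡⟨ r₂ K (a * b) (w (a * b)) ⟩
    a * b * (K * w (a * b)) ∎)
    where
    open ≡-Reasoning
    r₁ : ∀ a b c d → a * b * (c * d) ≡ (a * c) * (b * d)
    r₁ = solve-∀
    r₂ : ∀ a b c → a * (b * c) ≡ b * (a * c)
    r₂ = solve-∀

  -- These are `K` times the sums τ, β and H(M) of the opening comment.
  τ β h : ℕ
  τ = ∑ M λ t → good M t * w t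
  β = ∑ M λ u → bad M u * w u
  h = ∑ M w

  r₃ : ∀ a b c d → a * b * (c * d) ≡ a * c * (b * d)
  r₃ = solve-∀

  -- Every 0 < n < M is a good t times a bad u, both below `M`, so expanding `τ * β` meets `K * w n`
  -- at least once for each n.
  Kh≤τβ : K * h ≤ τ * β
  Kh≤τβ = begin
    K * h                             ≡⟨ ∑-*ˡ M K w ⟨
    ∑ M (λ n → K * w n)               ≤⟨ ∑-mono M term ⟩
    ∑ M (λ n → F n)                   ≡⟨ ∑-cong M (λ n n<M → sym (trans (cong (F n *_) (𝟙-yes (n <? M) n<M)) (*-identityʳ (F n)))) ⟩
    ∑ M (λ n → F n * 𝟙 (n <? M))      ≡⟨ ∑∑-fibres M (λ _ → M) M _*_ (λ t u → G t * H u) (λ n → 𝟙 (n <? M)) (λ n M≤n → 𝟙-no (n <? M) (≤⇒≯ M≤n)) ⟨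
    ∑ M (λ t → ∑ M (λ u → G t * H u * 𝟙 (t * u <? M)))
      ≤⟨ ∑-mono M (λ t _ → ∑-mono M λ u _ → ≤-trans (*-monoʳ-≤ (G t * H u) (𝟙≤1 (t * u <? M))) (≤-reflexive (*-identityʳ _))) ⟩
    ∑ M (λ t → ∑ M (λ u → G t * H u)) ≡⟨ ∑*∑ M M G H ⟨
    τ * β                             ∎
    where
    open ≤-Reasoning
    G H F : ℕ → ℕ
    G t = good M t * w t
    H u = bad M u * w u
    F n = ∑ M λ t → ∑ M λ u → 𝟙 (t * u ≟ n) * (G t * H u)
    term : ∀ n → n < M → K * w n ≤ F n
    term zero _ rewrite w-zero | *-zeroʳ K = z≤n
    term n@(suc _) n<M with good×bad M n z<s
    ... | t , u , tu≡n , gt , bu = begin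
      K * w n                                   ≡⟨ cong (λ x → K * w x) tu≡n ⟨
      K * w (t * u)                             ≡⟨ w-* t u (<-≤-trans tu<M M≤X) ⟨
      w t * w u                                 ≡⟨ cong₂ _*_ (*-identityˡ (w t)) (*-identityˡ (w u)) ⟨
      1 * w t * (1 * w u)                       ≡⟨ cong₂ (λ x y → x * w t * (y * w u)) (𝟙-yes (good? M t) gt) (𝟙-yes (bad? M u) bu) ⟨
      G t * H u                                 ≡⟨ *-identityˡ _ ⟨
      1 * (G t * H u)                           ≡⟨ cong (_* (G t * H u)) (𝟙-yes (t * u ≟ n) tu≡n) ⟨
      𝟙 (t * u ≟ n) * (G t * H u)               ≤⟨ term≤∑ (λ u → 𝟙 (t * u ≟ n) * (G t * H u)) u<M ⟩
      ∑ M (λ u → 𝟙 (t * u ≟ n) * (G t * H u))   ≤⟨ term≤∑ (λ t → ∑ M λ u → 𝟙 (t * u ≟ n) * (G t * H u)) t<M ⟩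
      F n                                       ∎
      where
      0<tu : 0 < t * u
      0<tu = subst (0 <_) (sym tu≡n) z<s
      tu<M : t * u < M
      tu<M = subst (_< M) (sym tu≡n) n<M
      t<M : t < M
      t<M = ≤-<-trans (m≤m*n t u {{>-nonZero (factor>0ʳ t u 0<tu)}}) tu<M
      u<M : u < M
      u<M = ≤-<-trans (m≤n*m u t {{>-nonZero (factor>0ˡ t u 0<tu)}}) tu<M

  -- The coefficient of 1/n when τ² is expanded.
  pairs : ℕ → ℕ
  pairs n = ∑ M λ t → ∑ M λ t′ → 𝟙 (t * t′ ≟ n) * (good M t * good M t′)

  τ²-pairs : τ * τ ≡ K * ∑ X (λ n → pairs n * w n)
  τ²-pairs = begin
    τ * τ
      ≡⟨ ∑*∑ M M _ _ ⟩
    ∑ M (λ t → ∑ M (λ t′ → good M t * w t * (good M t′ * w t′)))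
      -- Here t t′ < M², so the cut-off in `w` loses nothing.
      ≡⟨ ∑-cong M (λ t t<M → ∑-cong M λ t′ t′<M → trans (r₃ (good M t) (w t) (good M t′) (w t′))
           (trans (cong (good M t * good M t′ *_) (w-* t t′ (*-mono-< t<M t′<M)))
                  (r₄ (good M t * good M t′) K (w (t * t′))))) ⟩
    ∑ M (λ t → ∑ M (λ t′ → K * (good M t * good M t′ * w (t * t′))))
      ≡⟨ trans (∑-cong M λ t _ → ∑-*ˡ M K _) (∑-*ˡ M K _) ⟩
    K * ∑ M (λ t → ∑ M (λ t′ → good M t * good M t′ * w (t * t′)))
      ≡⟨ cong (K *_) (∑∑-fibres M (λ _ → M) X _*_ (λ t t′ → good M t * good M t′) w w-out) ⟩
    K * ∑ X (λ n → pairs n * w n) ∎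
    where
    open ≡-Reasoning
    r₄ : ∀ a b c → a * (b * c) ≡ b * (a * c)
    r₄ = solve-∀

  -- If some good pair has product n, all prime factors of n are 1 mod 4: then `divs 3` vanishes,
  -- and the first member of a pair is a divisor that determines the second. Otherwise `pairs n` is
  -- 0 and `divs₃≤divs₁` suffices.
  pairs+divs₃≤divs₁ : ∀ {n} → 0 < n → n < X → pairs n + divs 3 X n ≤ divs 1 X n
  pairs+divs₃≤divs₁ {n} 0<n n<X with pairs n ≟ 0
  ... | yes eq rewrite eq = divs₃≤divs₁ n 0<n n<X
  ... | no ≢0 with ∑≢0⇒∃ M ≢0
  ... | t , t<M , ≢0′ with ∑≢0⇒∃ M ≢0′
  ... | t′ , t′<M , ≢0″ = begin
    pairs n + divs 3 X n ≡⟨ cong (pairs n +_) (divs₃≡0 X 0<n one) ⟩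
    pairs n + 0          ≡⟨ +-identityʳ _ ⟩
    pairs n              ≤⟨ ∑-mono M (λ d _ → row d) ⟩
    divs 1 M n           ≤⟨ ∑-≤ _ M≤X ⟩
    divs 1 X n           ∎
    where
    open ≤-Reasoning
    tt′≡n : t * t′ ≡ n
    tt′≡n = 𝟙≢0 (t * t′ ≟ n) (*≢0ˡ _ (good M t * good M t′) ≢0″)
    gg≢0 : good M t * good M t′ ≢ 0
    gg≢0 = *≢0ʳ (𝟙 (t * t′ ≟ n)) _ ≢0″
    gt : Good M t
    gt = 𝟙≢0 (good? M t) (*≢0ˡ _ (good M t′) gg≢0)
    gt′ : Good M t′
    gt′ = 𝟙≢0 (good? M t′) (*≢0ʳ (good M t) _ gg≢0)
    0<tt′ : 0 < t * t′
    0<tt′ = subst (0 <_) (sym tt′≡n) 0<n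
    one : ∀ {p} → Prime p → p ∣ n → p % 4 ≡ 1
    one pp p∣n with euclidsLemma t t′ pp (subst (_ ∣_) (sym tt′≡n) p∣n)
    ... | inj₁ p∣t  = gt (≤-<-trans (∣⇒≤ {{>-nonZero (factor>0ˡ t t′ 0<tt′)}} p∣t) t<M) pp p∣t
    ... | inj₂ p∣t′ = gt′ (≤-<-trans (∣⇒≤ {{>-nonZero (factor>0ʳ t t′ 0<tt′)}} p∣t′) t′<M) pp p∣t′
    row : ∀ d → ∑ M (λ e → 𝟙 (d * e ≟ n) * (good M d * good M e)) ≤ 𝟙 (d % 4 ≟ 1) * 𝟙 (d ∣? n)
    row d with d ∣? n
    ... | no d∤n = ≤-trans (≤-reflexive (∑-zero M λ e _ → cong (_* (good M d * good M e))
                     (𝟙-no (d * e ≟ n) λ { refl → d∤n (m∣m*n e) }))) z≤n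
    ... | yes d∣n rewrite 𝟙-yes (d % 4 ≟ 1) (divisor-1mod4 0<n one d∣n) = ∑-≤1 M
        (λ e _ → *-mono-≤ (𝟙≤1 (d * e ≟ n)) (*-mono-≤ (𝟙≤1 (good? M d)) (𝟙≤1 (good? M e))))
        λ e e′ _ _ p p′ → *-cancelˡ-≡ e e′ d {{≢-nonZero λ { refl → <⇒≢ 0<n (sym (0∣⇒≡0 d∣n)) }}}
          (trans (𝟙≢0 (d * e ≟ n) (*≢0ˡ _ _ p)) (sym (𝟙≢0 (d * e′ ≟ n) (*≢0ˡ _ _ p′))))

  divs-weighted : ∀ ρ → 0 < ρ → ∑ X (λ n → divs ρ X n * w n) ≡
                  ∑ X (λ e → ∑ X (λ d → 𝟙 (d % 4 ≟ ρ) * w (d * e)))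
  divs-weighted ρ 0<ρ = begin
    ∑ X (λ n → divs ρ X n * w n)
      ≡⟨ ∑-cong X (λ n _ → sym (∑-*ʳ X _ (w n))) ⟩
    ∑ X (λ n → ∑ X (λ d → 𝟙 (d % 4 ≟ ρ) * 𝟙 (d ∣? n) * w n))
      ≡⟨ ∑-swap X X _ ⟩
    ∑ X (λ d → ∑ X (λ n → 𝟙 (d % 4 ≟ ρ) * 𝟙 (d ∣? n) * w n))
      ≡⟨ ∑-cong X (λ d _ → trans (∑-cong X λ n _ → *-assoc (𝟙 (d % 4 ≟ ρ)) _ _)
                          (trans (∑-*ˡ X (𝟙 (d % 4 ≟ ρ)) _) (trans (col d) (sym (∑-*ˡ X (𝟙 (d % 4 ≟ ρ)) _))))) ⟩
    ∑ X (λ d → ∑ X (λ e → 𝟙 (d % 4 ≟ ρ) * w (d * e)))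
      ≡⟨ ∑-swap X X _ ⟩
    ∑ X (λ e → ∑ X (λ d → 𝟙 (d % 4 ≟ ρ) * w (d * e))) ∎
    where
    open ≡-Reasoning
    col : ∀ d → 𝟙 (d % 4 ≟ ρ) * ∑ X (λ n → 𝟙 (d ∣? n) * w n) ≡ 𝟙 (d % 4 ≟ ρ) * ∑ X (λ e → w (d * e))
    col d with d % 4 ≟ ρ
    ... | no _    = refl
    -- A positive residue excludes d = 0.
    ... | yes d≡ρ = cong (1 *_) (sym (∑-multiples {d} X w (n≢0⇒n>0 λ { refl → <⇒≢ 0<ρ d≡ρ }) w-out))

  -- Writing n = d e turns the bound on `pairs` into a sum over e of alternating sums over d, each
  -- at most its first term `w e`. The part with d ≡ 3 is carried on both sides and cancelled at the
  -- end.
  τ²≤K∑w : τ * τ ≤ K * ∑ X w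
  τ²≤K∑w = ≤-trans (≤-reflexive τ²-pairs) (*-monoʳ-≤ K (+-cancelʳ-≤ D₃ _ _ (begin
    ∑ X (λ n → pairs n * w n) + D₃                  ≡⟨ ∑-+ X _ _ ⟨
    ∑ X (λ n → pairs n * w n + divs 3 X n * w n)    ≤⟨ ∑-mono X (λ n n<X → ≤-trans (≤-reflexive (sym (*-distribʳ-+ (w n) (pairs n) _))) (le n n<X)) ⟩
    ∑ X (λ n → divs 1 X n * w n)                    ≡⟨ divs-weighted 1 z<s ⟩
    ∑ X (λ e → ∑ X (λ d → 𝟙 (d % 4 ≟ 1) * w (d * e))) ≤⟨ ∑-mono X (λ e _ → row e) ⟩
    ∑ X (λ e → w e + ∑ X (λ d → 𝟙 (d % 4 ≟ 3) * w (d * e))) ≡⟨ ∑-+ X w _ ⟩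
    ∑ X w + ∑ X (λ e → ∑ X (λ d → 𝟙 (d % 4 ≟ 3) * w (d * e))) ≡⟨ cong (∑ X w +_) (divs-weighted 3 z<s) ⟨
    ∑ X w + D₃ ∎)))
    where
    open ≤-Reasoning
    D₃ = ∑ X (λ n → divs 3 X n * w n)
    le : ∀ n → n < X → (pairs n + divs 3 X n) * w n ≤ divs 1 X n * w n
    le zero    _   rewrite w-zero | *-zeroʳ (pairs 0 + divs 3 X 0) = z≤n
    le (suc n) n<X = *-monoˡ-≤ (w (suc n)) (pairs+divs₃≤divs₁ z<s n<X)
    row : ∀ e → ∑ X (λ d → 𝟙 (d % 4 ≟ 1) * w (d * e)) ≤ w e + ∑ X (λ d → 𝟙 (d % 4 ≟ 3) * w (d * e))
    row zero = ≤-trans (≤-reflexive (∑-zero X λ d _ → trans (cong (λ x → 𝟙 (d % 4 ≟ 1) * w x) (*-zeroʳ d))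
                 (trans (cong (𝟙 (d % 4 ≟ 1) *_) w-zero) (*-zeroʳ (𝟙 (d % 4 ≟ 1)))))) z≤n
    row e@(suc _) = subst (λ x → ∑ X (λ d → 𝟙 (d % 4 ≟ 1) * w (d * e)) ≤ w x + ∑ X (λ d → 𝟙 (d % 4 ≟ 3) * w (d * e))) (*-identityˡ e)
      (alternating-sum X (λ d → w (d * e)) λ {i} {j} 0<i i≤j → w-anti (*-mono-≤ {1} {i} {1} {e} 0<i z<s) (*-monoˡ-≤ e i≤j))

  Good⇒>0 : ∀ {n} → Good M n → 0 < n
  Good⇒>0 {zero}  g = contradiction (g {2} 3≤M prime[2] (2 ∣0)) λ ()
  Good⇒>0 {suc _} g = z<s

  -- A common prime factor is at most u, hence below `M`, and would be tested by both conditions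
  -- with opposite results.
  bad-good-coprime : ∀ {u s} → 0 < u → u < M → Bad M u → Good M s → Coprime u s
  bad-good-coprime {u} 0<u u<M bu gs {zero} (0∣u , _) = contradiction (0∣⇒≡0 0∣u) (>⇒≢ 0<u)
  bad-good-coprime {u} 0<u u<M bu gs {1} _ = refl
  bad-good-coprime {u} 0<u u<M bu gs {d@(suc (suc _))} (d∣u , d∣s) with primeDivisor {d} (s<s z<s)
  ... | q , pq , q∣d = contradiction (gs q<M pq (∣-trans q∣d d∣s)) (bu q<M pq (∣-trans q∣d d∣u))
    where
    q<M : q < M
    q<M = ≤-<-trans (∣⇒≤ {{>-nonZero 0<u}} (∣-trans q∣d d∣u)) u<M

  module _ (Q : ℕ) (periodic : ∀ n → good M (Q + n) ≡ good M n) where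

    period-count : ∀ k → ∑ (k * Q) (good M) ≡ k * ∑ Q (good M)
    period-count zero    = refl
    period-count (suc k) = trans (∑-split Q (k * Q) (good M))
      (cong (∑ Q (good M) +_) (trans (∑-cong (k * Q) λ i _ → periodic i) (period-count k)))

    -- (u , s) ↦ u * s is injective on pairs with u bad and s good.
    β-count : β * ∑ Q (good M) ≤ K * Q
    β-count = begin
      β * ∑ Q (good M)
        ≡⟨ ∑-*ʳ M _ (∑ Q (good M)) ⟨
      ∑ M (λ u → bad M u * w u * ∑ Q (good M))
        -- Let s run through `w u` periods: then u s < u · w u · Q = K Q for every u.
        ≡⟨ ∑-cong M (λ u _ → trans (*-assoc (bad M u) (w u) _) (trans (cong (bad M u *_) (sym (period-count (w u))))
             (sym (∑-*ˡ (w u * Q) (bad M u) (good M))))) ⟩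
      ∑ M (λ u → ∑ (w u * Q) (λ s → bad M u * good M s))
        ≡⟨ ∑-cong M (λ u u<M → ∑-cong (w u * Q) λ s s<wQ → sym (trans (cong (bad M u * good M s *_)
             (𝟙-yes (u * s <? K * Q) (us<KQ u s u<M s<wQ))) (*-identityʳ _))) ⟩
      ∑ M (λ u → ∑ (w u * Q) (λ s → bad M u * good M s * 𝟙 (u * s <? K * Q)))
        ≡⟨ ∑∑-fibres M (λ u → w u * Q) (K * Q) _*_ (λ u s → bad M u * good M s) (λ x → 𝟙 (x <? K * Q))
             (λ x out → 𝟙-no (x <? K * Q) (≤⇒≯ out)) ⟩
      ∑ (K * Q) (λ x → fibre x * 𝟙 (x <? K * Q))
        ≤⟨ ∑-mono (K * Q) (λ x _ → *-mono-≤ (fibre≤1 x) (𝟙≤1 (x <? K * Q))) ⟩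
      ∑ (K * Q) (λ x → 1)
        ≡⟨ trans (∑-const (K * Q) 1) (*-identityʳ _) ⟩
      K * Q ∎
      where
      open ≤-Reasoning
      us<KQ : ∀ u s → u < M → s < w u * Q → u * s < K * Q
      us<KQ zero s _ s<wQ rewrite w-zero = contradiction s<wQ λ ()
      us<KQ u@(suc _) s u<M s<wQ = subst (u * s <_) (trans (sym (*-assoc u (w u) Q)) (cong (_* Q) (w-eq z<s (<-≤-trans u<M M≤X))))
                                     (*-monoʳ-< u s<wQ)
      fibre : ℕ → ℕ
      fibre x = ∑ M λ u → ∑ (w u * Q) λ s → 𝟙 (u * s ≟ x) * (bad M u * good M s)
      row≤1 : ∀ x u → ∑ (w u * Q) (λ s → 𝟙 (u * s ≟ x) * (bad M u * good M s)) ≤ 1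
      row≤1 x zero rewrite w-zero = z≤n
      row≤1 x u@(suc _) = ∑-≤1 (w u * Q)
        (λ s _ → *-mono-≤ (𝟙≤1 (u * s ≟ x)) (*-mono-≤ (𝟙≤1 (bad? M u)) (𝟙≤1 (good? M s))))
        λ s s′ _ _ p p′ → *-cancelˡ-≡ s s′ u
          (trans (𝟙≢0 (u * s ≟ x) (*≢0ˡ _ _ p)) (sym (𝟙≢0 (u * s′ ≟ x) (*≢0ˡ _ _ p′))))
      witness : ∀ {x u} → ∑ (w u * Q) (λ s → 𝟙 (u * s ≟ x) * (bad M u * good M s)) ≢ 0 →
                ∃[ s ] 0 < u × u * s ≡ x × Bad M u × Good M s
      witness {x} {zero} ≢0 rewrite w-zero = contradiction refl ≢0
      witness {x} {u@(suc _)} ≢0 with ∑≢0⇒∃ (w u * Q) ≢0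
      ... | s , _ , p = s , z<s , 𝟙≢0 (u * s ≟ x) (*≢0ˡ _ (bad M u * good M s) p)
                          , 𝟙≢0 (bad? M u) (*≢0ˡ _ (good M s) (*≢0ʳ (𝟙 (u * s ≟ x)) _ p))
                          , 𝟙≢0 (good? M s) (*≢0ʳ (bad M u) _ (*≢0ʳ (𝟙 (u * s ≟ x)) _ p))
      divides-other : ∀ {u u′ s s′} → 0 < u → u < M → Bad M u → Good M s′ → u * s ≡ u′ * s′ → u ∣ u′
      divides-other {u} {u′} {s} {s′} 0<u u<M bu gs′ eq = coprime-divisor
        (bad-good-coprime 0<u u<M bu gs′) (divides s (trans (*-comm s′ u′) (trans (sym eq) (*-comm u s))))
      fibre≤1 : ∀ x → fibre x ≤ 1
      fibre≤1 x = ∑-≤1 M (λ u _ → row≤1 x u) λ u u′ u<M u′<M p p′ →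
        let (s , 0<u , us≡x , bu , gs)       = witness {x} {u} p
            (s′ , 0<u′ , us≡x′ , bu′ , gs′) = witness {x} {u′} p′
        -- Each of u and u′ divides the other, u being coprime to s′ and u′ to s.
        in ∣-antisym (divides-other 0<u u<M bu gs′ (trans us≡x (sym us≡x′)))
                     (divides-other 0<u′ u′<M bu′ gs (trans us≡x′ (sym us≡x)))

-- Dyadic bounds and the sparsity of good integers

module _ (X K : ℕ) where

  weight : ℕ → ℕ
  weight zero      = 0
  weight n@(suc _) with n <? X
  ... | yes _ = K / n
  ... | no  _ = 0

  weight-out : ∀ n → X ≤ n → weight n ≡ 0
  weight-out zero      _   = refl
  weight-out n@(suc _) X≤n with n <? X
  ... | yes n<X = contradiction n<X (≤⇒≯ X≤n)
  ... | no  _   = refl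

  weight-eq : (∀ {n} → 0 < n → n < X → n ∣ K) → ∀ {n} → 0 < n → n < X → n * weight n ≡ K
  weight-eq ∣K {n@(suc _)} 0<n n<X with n <? X
  ... | yes _  = m*[n/m]≡n (∣K 0<n n<X)
  ... | no n≮X = contradiction n<X n≮X

n∣m! : ∀ {n m} → 0 < n → n ≤ m → n ∣ m !
n∣m! {suc n} _ n≤m = ∣-trans (m∣m*n (n !)) (m≤n⇒m!∣n! n≤m)

module Dyadic (X K : ℕ) (w : ℕ → ℕ) (w-zero : w 0 ≡ 0)
              (w-eq : ∀ {n} → 0 < n → n < X → n * w n ≡ K) where

  open ≤-Reasoning

  -- The sum over p ≤ n < 2p, where K / n lies between K / (2p) and K / p; with p terms the block
  -- lies between K / 2 and K.
  block : ℕ → ℕ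
  block p = ∑ p λ j → w (p + j)

  block-eq : ∀ {p} → 0 < p → p + p ≤ X → ∑ p (λ j → (p + j) * w (p + j)) ≡ p * K
  block-eq {p} 0<p p+p≤X = trans
    (∑-cong p λ j j<p → w-eq (≤-trans 0<p (m≤m+n p j)) (<-≤-trans (+-monoʳ-< p j<p) p+p≤X))
    (∑-const p K)

  block≤K : ∀ {p} → 0 < p → p + p ≤ X → block p ≤ K
  block≤K {p} 0<p p+p≤X = *-cancelˡ-≤ p {{>-nonZero 0<p}} (begin
    p * block p                         ≡⟨ ∑-*ˡ p p _ ⟨
    ∑ p (λ j → p * w (p + j))           ≤⟨ ∑-mono p (λ j _ → *-monoˡ-≤ (w (p + j)) (m≤m+n p j)) ⟩
    ∑ p (λ j → (p + j) * w (p + j))     ≡⟨ block-eq 0<p p+p≤X ⟩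
    p * K                               ∎)

  K≤2block : ∀ {p} → 0 < p → p + p ≤ X → K ≤ 2 * block p
  K≤2block {p} 0<p p+p≤X = *-cancelˡ-≤ p {{>-nonZero 0<p}} (begin
    p * K                               ≡⟨ block-eq 0<p p+p≤X ⟨
    ∑ p (λ j → (p + j) * w (p + j))     ≤⟨ ∑-mono p (λ j j<p → *-monoˡ-≤ (w (p + j)) (+-monoʳ-≤ p (<⇒≤ j<p))) ⟩
    ∑ p (λ j → (p + p) * w (p + j))     ≡⟨ ∑-*ˡ p (p + p) _ ⟩
    (p + p) * block p                   ≡⟨ double p (block p) ⟩
    p * (2 * block p)                   ∎)
    where
    double : ∀ p b → (p + p) * b ≡ p * (2 * b)
    double = solve-∀

  double-range : ∀ i → ∑ (2 ^ suc i) w ≡ ∑ (2 ^ i) w + block (2 ^ i)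
  double-range i = trans (cong (λ n → ∑ (2 ^ i + n) w) (+-identityʳ (2 ^ i))) (∑-split (2 ^ i) (2 ^ i) w)

  halves≤ : ∀ {i} → 2 ^ suc i ≤ X → 2 ^ i + 2 ^ i ≤ X
  halves≤ {i} = subst (λ n → 2 ^ i + n ≤ X) (+-identityʳ (2 ^ i))

  half≤ : ∀ {i} → 2 ^ suc i ≤ X → 2 ^ i ≤ X
  half≤ {i} = ≤-trans (m≤m+n (2 ^ i) _)

  ∑-upper : ∀ i → 2 ^ i ≤ X → ∑ (2 ^ i) w ≤ i * K
  ∑-upper zero    _  rewrite w-zero = z≤n
  ∑-upper (suc i) le = begin
    ∑ (2 ^ suc i) w             ≡⟨ double-range i ⟩
    ∑ (2 ^ i) w + block (2 ^ i) ≤⟨ +-mono-≤ (∑-upper i (half≤ {i} le)) (block≤K (m^n>0 2 i) (halves≤ {i} le)) ⟩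
    i * K + K                   ≡⟨ +-comm (i * K) K ⟩
    suc i * K                   ∎

  ∑-lower : ∀ i → 2 ^ i ≤ X → i * K ≤ 2 * ∑ (2 ^ i) w
  ∑-lower zero    _  = z≤n
  ∑-lower (suc i) le = begin
    suc i * K                               ≡⟨ +-comm K (i * K) ⟩
    i * K + K                               ≤⟨ +-mono-≤ (∑-lower i (half≤ {i} le)) (K≤2block (m^n>0 2 i) (halves≤ {i} le)) ⟩
    2 * ∑ (2 ^ i) w + 2 * block (2 ^ i)     ≡⟨ *-distribˡ-+ 2 (∑ (2 ^ i) w) _ ⟨
    2 * (∑ (2 ^ i) w + block (2 ^ i))       ≡⟨ cong (2 *_) (double-range i) ⟨
    2 * ∑ (2 ^ suc i) w                     ∎

-- Each prime below `M` divides `M !`.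
good-periodic : ∀ M n → good M (M ! + n) ≡ good M n
good-periodic M n = 𝟙-cong (good? M (M ! + n)) (good? M n)
  (λ g {p} p<M pp p∣n → g {p} p<M pp (∣m∣n⇒∣m+n (n∣m! (prime>0 pp) (<⇒≤ p<M)) p∣n))
  (λ g {p} p<M pp p∣M!+n → g {p} p<M pp (∣m+n∣m⇒∣n p∣M!+n (n∣m! (prime>0 pp) (<⇒≤ p<M))))

square-cancel : ∀ m n → m * m ≤ n * n → m ≤ n
square-cancel m n mm≤nn with m ≤? n
... | yes m≤n = m≤n
... | no  m≰n = contradiction mm≤nn (<⇒≱ (*-mono-< (≰⇒> m≰n) (≰⇒> m≰n)))

-- The bounds give β² ≥ K h² / H ≥ K (J K / 2)² / (2 J K) = J K² / 8, which is (k K)² by the choice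
-- of J.
kK≤β-from-bounds : ∀ K k h τ β H → 0 < K → 0 < k → let J = 8 * (k * k) in
          J * K ≤ 2 * h → K * h ≤ τ * β → τ * τ ≤ K * H → H ≤ (J + J) * K → k * K ≤ β
kK≤β-from-bounds K k h τ β H 0<K 0<k JK≤2h Kh≤τβ ττ≤KH H≤2JK =
  square-cancel (k * K) β (*-cancelˡ-≤ (8 * J * (K * K)) {{nz}} (begin
    8 * J * (K * K) * (k * K * (k * K))     ≡⟨ e₁ K k ⟩
    K * (J * K) * (K * (J * K))             ≤⟨ *-mono-≤ KJK≤ KJK≤ ⟩
    2 * (τ * β) * (2 * (τ * β))             ≡⟨ e₂ τ β ⟩
    4 * (β * β) * (τ * τ)                   ≤⟨ *-monoʳ-≤ (4 * (β * β)) (≤-trans ττ≤KH (*-monoʳ-≤ K H≤2JK)) ⟩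
    4 * (β * β) * (K * ((J + J) * K))       ≡⟨ e₃ K β J ⟩
    8 * J * (K * K) * (β * β)               ∎))
  where
  open ≤-Reasoning
  J = 8 * (k * k)
  e₁ : ∀ K k → 8 * (8 * (k * k)) * (K * K) * (k * K * (k * K)) ≡ K * (8 * (k * k) * K) * (K * (8 * (k * k) * K))
  e₁ = solve-∀
  e₂ : ∀ τ β → 2 * (τ * β) * (2 * (τ * β)) ≡ 4 * (β * β) * (τ * τ)
  e₂ = solve-∀
  e₃ : ∀ K β J → 4 * (β * β) * (K * ((J + J) * K)) ≡ 8 * J * (K * K) * (β * β)
  e₃ = solve-∀
  e₄ : ∀ K h → K * (2 * h) ≡ 2 * (K * h)
  e₄ = solve-∀
  KJK≤ : K * (J * K) ≤ 2 * (τ * β)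
  KJK≤ = ≤-trans (*-monoʳ-≤ K JK≤2h) (≤-trans (≤-reflexive (e₄ K h)) (*-monoʳ-≤ 2 Kh≤τβ))
  nz : NonZero (8 * J * (K * K))
  nz = >-nonZero (*-mono-< {0} {8 * J} {0} {K * K} (*-mono-< {0} {8} {0} {J} z<s (*-mono-< {0} {8} {0} {k * k} z<s (*-mono-< 0<k 0<k))) (*-mono-< 0<K 0<K))

-- For some `M`, good integers have density at most 1/k, expressed by their number in one period.
GoodSparse : ℕ → Set
GoodSparse k = ∃[ M ] ∃[ Q ] 0 < Q × k * ∑ Q (good M) ≤ Q × (∀ j → ∑ (j * Q) (good M) ≡ j * ∑ Q (good M))

good-sparse : ∀ k → 0 < k → GoodSparse k
good-sparse k 0<k = go (2 ^ J) refl
  where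
  J = 8 * (k * k)
  1≤k² : 1 ≤ k * k
  1≤k² = *-mono-≤ {1} {k} {1} {k} 0<k 0<k
  go : ∀ M → M ≡ 2 ^ J → GoodSparse k
  go M M≡ = M , M ! , 1≤n! M , conclusion , period-count (M !) (good-periodic M)
    where
    open ≤-Reasoning
    -- A common multiple of all 0 < n < M², so that K / n is exact.
    K = (M * M) !
    w = weight (M * M) K
    w-eq : ∀ {n} → 0 < n → n < M * M → n * w n ≡ K
    w-eq = weight-eq (M * M) K (λ 0<n n<X → n∣m! 0<n (<⇒≤ n<X))
    3≤M : 3 ≤ M
    3≤M = begin
      3           ≤⟨ s≤s (s≤s (s≤s z≤n)) ⟩
      2 ^ 2       ≤⟨ ^-monoʳ-≤ 2 (≤-trans (s≤s (s≤s z≤n)) (*-monoʳ-≤ 8 1≤k²)) ⟩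
      2 ^ J       ≡⟨ M≡ ⟨
      M           ∎
    open Weighted M K 3≤M (1≤n! (M * M)) w refl (weight-out (M * M) K) w-eq
    open Dyadic (M * M) K w refl w-eq
    X≡ : X ≡ 2 ^ (J + J)
    X≡ = trans (cong₂ _*_ M≡ M≡) (sym (^-distribˡ-+-* 2 J J))
    kK≤β : k * K ≤ β
    kK≤β = kK≤β-from-bounds K k h τ β (∑ X w) (1≤n! X) 0<k
      (subst (λ m → J * K ≤ 2 * ∑ m w) (sym M≡) (∑-lower J (subst (_≤ X) M≡ M≤X)))
      Kh≤τβ τ²≤K∑w
      (subst (λ x → ∑ x w ≤ (J + J) * K) (sym X≡) (∑-upper (J + J) (≤-reflexive (sym X≡))))
    c = ∑ (M !) (good M)
    conclusion : k * c ≤ M !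
    conclusion = *-cancelˡ-≤ K {{>-nonZero (1≤n! X)}} (begin
      K * (k * c)   ≡⟨ trans (sym (*-assoc K k c)) (cong (_* c) (*-comm K k)) ⟩
      k * K * c     ≤⟨ *-monoˡ-≤ c kK≤β ⟩
      β * c         ≤⟨ β-count (M !) (good-periodic M) ⟩
      K * M !       ∎)

-- Counting fertility numbers

¬Good⇒prime : ∀ M {n} → ¬ Good M n → ∃[ p ] p < M × Prime p × p ∣ n × p % 4 ≢ 1
¬Good⇒prime M {n} ¬g with anyUpTo? (λ p → prime? p ×-dec ((p ∣? n) ×-dec ¬? (p % 4 ≟ 1))) M
... | yes (p , p<M , pp , p∣n , ≢1) = p , p<M , pp , p∣n , ≢1
... | no none = contradiction (λ {p} → good-at p) ¬g
  where
  good-at : ∀ p → p < M → Prime p → p ∣ n → p % 4 ≡ 1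
  good-at p p<M pp p∣n with p % 4 ≟ 1
  ... | yes ≡1 = ≡1
  ... | no  ≢1 = contradiction (p , p<M , pp , p∣n , ≢1) none

mod4-form : ∀ {n r} → n % 4 ≡ r → n ≡ r + n / 4 * 4
mod4-form {n} refl = m≡m%n+[m/n]*n n 4

fertile-2∣ : ∀ {n} → 0 < n → 2 ∣ n → FertilityNumber n
fertile-2∣ 0<n (divides (suc q) refl) = subst FertilityNumber (*-comm 2 (suc q)) (fertile-even q)

fertile-1mod4 : ∀ {n} → 1 < n → n % 4 ≡ 1 → FertilityNumber n
fertile-1mod4 {n} 1<n ≡1 with n / 4 | mod4-form {n} ≡1
... | zero  | refl = contradiction 1<n (<-irrefl refl)
... | suc k | refl = subst FertilityNumber (eq k) (fertile-product 0 k)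
  where
  eq : ∀ k → 1 * (2 * 1 + 3 + 4 * k) ≡ 1 + suc k * 4
  eq = solve-∀

-- Here q ≡ 1 ≡ 2p + 3 mod 4, so q = 2p + 3 + 4c for some c, and `fertile-product` applies with a =
-- p.
fertile-3* : ∀ {p q} → p % 4 ≡ 3 → (p * q) % 4 ≡ 3 → 2 * p + 3 ≤ q → FertilityNumber (p * q)
fertile-3* {p} {q} p≡3 pq≡3 le with p / 4 | mod4-form {p} p≡3 | q / 4 | mod4-form {q} q≡1
  where
  q≡1 : q % 4 ≡ 1
  q≡1 = residue-cases (λ r → (3 * r) % 4 ≡ 3 → r ≡ 1) (λ ()) (λ _ → refl) (λ ()) (λ ()) q
          (trans (sym (3*-%4 p q p≡3)) pq≡3)
... | a | refl | b | refl = subst (λ x → FertilityNumber ((3 + a * 4) * x)) (trans (eq₂ a c) (cong (λ x → 1 + x * 4) b≡))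
                              (fertile-product (2 + a * 4) c)
  where
  eq₁ : ∀ a → 2 * (3 + a * 4) + 3 ≡ 1 + (2 + 2 * a) * 4
  eq₁ = solve-∀
  eq₂ : ∀ a c → 2 * (3 + a * 4) + 3 + 4 * c ≡ 1 + (2 + 2 * a + c) * 4
  eq₂ = solve-∀
  le′ : 2 + 2 * a ≤ b
  le′ = *-cancelʳ-≤ (2 + 2 * a) b 4 (≤-pred (subst (_≤ 1 + b * 4) (eq₁ a) le))
  c = b ∸ (2 + 2 * a)
  b≡ : 2 + 2 * a + c ≡ b
  b≡ = m+[n∸m]≡n le′

-- Large enough that n > 1 and that the cofactor in n of any prime factor p < M is at least 2p + 3.
threshold : ℕ → ℕ
threshold M = 2 + M * (2 * M + 3)

-- Even n and n ≡ 1 mod 4 are fertile by themselves. If n ≡ 3, the prime that violates `Good` is odd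
-- and not 1 mod 4, hence 3 mod 4.
¬Good⇒fertile : ∀ M {n} → threshold M ≤ n → ¬ Good M n → FertilityNumber n
¬Good⇒fertile M {n} large ¬g with 2 ∣? n
... | yes 2∣n = fertile-2∣ (≤-trans z<s large) 2∣n
... | no 2∤n with n % 4 in n%4 | m%n<n n 4
... | 0 | _ = contradiction (divides (n / 4 * 2) (trans (mod4-form {n} n%4) (sym (*-assoc (n / 4) 2 2)))) 2∤n
... | 1 | _ = fertile-1mod4 (≤-trans (s≤s (s≤s z≤n)) large) n%4
... | 2 | _ = contradiction (divides (1 + n / 4 * 2) (trans (mod4-form {n} n%4) (cong (λ x → 2 + x) (sym (*-assoc (n / 4) 2 2))))) 2∤n
... | suc (suc (suc (suc _))) | s≤s (s≤s (s≤s (s≤s ())))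
... | 3 | _ with ¬Good⇒prime M ¬g
...   | p , p<M , pp , p∣n@(divides q eq) , ≢1 with p % 4 ≟ 3
...     | no ≢3  = contradiction (subst (_∣ n) (even⇒2 pp ≢1 ≢3) p∣n) 2∤n
...     | yes ≡3 = subst FertilityNumber (sym n≡pq) (fertile-3* {p} {q} ≡3 (trans (cong (_% 4) (sym n≡pq)) n%4) (≮⇒≥ ¬small))
  where
  n≡pq : n ≡ p * q
  n≡pq = trans eq (*-comm q p)
  ¬small : ¬ q < 2 * p + 3
  ¬small q< = <⇒≱ (s≤s (≤-trans (≤-reflexive n≡pq) (*-mono-≤ (<⇒≤ p<M) (≤-trans (<⇒≤ q<) (+-monoˡ-≤ 3 (*-monoʳ-≤ 2 (<⇒≤ p<M)))))))
                 (≤-trans (n≤1+n _) large)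

unique-⊆-length : ∀ {xs ys : List ℕ} → Unique xs → (∀ {x} → x ∈ xs → x ∈ ys) → length xs ≤ length ys
unique-⊆-length {[]}     _        _ = z≤n
unique-⊆-length {x ∷ xs} (x∉ ∷ u) ⊆ with ∈-∃++ (⊆ (here refl))
... | as , bs , refl = ≤-trans (s≤s (unique-⊆-length u rest)) (≤-reflexive (sym len))
  where
  len : length (as ++ x ∷ bs) ≡ suc (length (as ++ bs))
  len = trans (length-++ as) (trans (+-suc (length as) _) (cong suc (sym (length-++ as))))
  rest : ∀ {y} → y ∈ xs → y ∈ as ++ bs
  rest y∈ with ∈-++⁻ as (⊆ (there y∈))
  ... | inj₁ y∈as         = ∈-++⁺ˡ y∈as
  ... | inj₂ (here refl)  = contradiction refl (All.lookup x∉ y∈)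
  ... | inj₂ (there y∈bs) = ∈-++⁺ʳ as y∈bs

length-filter-applyUpTo : ∀ {P : Pred ℕ 0ℓ} (P? : Decidable P) f n →
                          length (filter P? (applyUpTo f n)) ≡ ∑ n (λ i → 𝟙 (P? (f i)))
length-filter-applyUpTo P? f zero = refl
length-filter-applyUpTo P? f (suc n) with P? (f 0)
... | yes _ = cong suc (length-filter-applyUpTo P? (f ∘ suc) n)
... | no  _ = length-filter-applyUpTo P? (f ∘ suc) n

count≤ : ∀ {N c} → HasCardinality (FertilityNumber ∩[0, N ]) c → c ≤ suc N
count≤ {N} (xs , u , xs⇔ , refl) = subst (length xs ≤_) (length-applyUpTo id (suc N))
  (unique-⊆-length u λ x∈ → ∈-upTo⁺ (s≤s (proj₁ (Equivalence.to (xs⇔ _) x∈))))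

-- Each integer up to `N` is a fertility number, below the threshold, or good.
≤count+good : ∀ M {N c} → HasCardinality (FertilityNumber ∩[0, N ]) c →
              suc N ≤ c + (threshold M + ∑ (suc N) (good M))
≤count+good M {N} (xs , u , xs⇔ , refl) = begin
  suc N                           ≡⟨ length-applyUpTo id (suc N) ⟨
  length (upTo (suc N))           ≤⟨ unique-⊆-length (Unique.upTo⁺ (suc N)) covered ⟩
  length (xs ++ small ++ goods)   ≡⟨ trans (length-++ xs) (cong (λ x → length xs + x) (length-++ small)) ⟩
  length xs + (length small + length goods)
    ≡⟨ cong₂ (λ a b → length xs + (a + b)) (length-applyUpTo id (threshold M)) (length-filter-applyUpTo (good? M) id (suc N)) ⟩
  length xs + (threshold M + ∑ (suc N) (good M)) ∎
  where
  open ≤-Reasoning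
  small goods : List ℕ
  small = upTo (threshold M)
  goods = filter (good? M) (upTo (suc N))
  covered : ∀ {x} → x ∈ upTo (suc N) → x ∈ xs ++ small ++ goods
  covered {x} x∈ with x <? threshold M | good? M x
  ... | yes x<    | _     = ∈-++⁺ʳ xs (∈-++⁺ˡ (∈-upTo⁺ x<))
  ... | no  _     | yes g = ∈-++⁺ʳ xs (∈-++⁺ʳ small (∈-filter⁺ (good? M) x∈ g))
  ... | no  large | no ¬g = ∈-++⁺ˡ (Equivalence.from (xs⇔ x)
                              (≤-pred (∈-upTo⁻ x∈) , ¬Good⇒fertile M (≮⇒≥ large) ¬g))

-- Eventually |c / N - 1| ≤ 1 / k, with denominators cleared.
CountWithin : ℕ → Set
CountWithin k = ∃[ N₀ ] (∀ N → N₀ ≤ N → ∀ c → HasCardinality (FertilityNumber ∩[0, N ]) c →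
                         k * ∣ c - N ∣ ≤ N)

sparse⇒count-within : ∀ k → GoodSparse (2 * k) → CountWithin k
sparse⇒count-within k (M , Q , 0<Q , sparse , periodic) = N₀ , close
  where
  instance Q≢0 = >-nonZero 0<Q
  C = ∑ Q (good M)
  L = threshold M
  -- The summands absorb the integers below the threshold, the incomplete last period, and the fact
  -- that 0, ..., N are N + 1 integers. The factor 2 in the sparsity leaves room for the first two.
  N₀ = 2 * k * L + Q + k

  module _ (N : ℕ) (N₀≤N : N₀ ≤ N) (c : ℕ) (counted : HasCardinality (FertilityNumber ∩[0, N ]) c) where
    open ≤-Reasoning

    G = ∑ (suc N) (good M)

    good-count : 2 * k * G ≤ Q + N
    good-count = begin
      2 * k * G                               ≤⟨ *-monoʳ-≤ (2 * k) (∑-≤ (good M) N<) ⟩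
      2 * k * ∑ (suc (N / Q) * Q) (good M)    ≡⟨ cong (2 * k *_) (periodic (suc (N / Q))) ⟩
      2 * k * (suc (N / Q) * C)               ≡⟨ rearrange (2 * k) (suc (N / Q)) C ⟩
      suc (N / Q) * (2 * k * C)               ≤⟨ *-monoʳ-≤ (suc (N / Q)) sparse ⟩
      Q + N / Q * Q                           ≤⟨ +-monoʳ-≤ Q (m/n*n≤m N Q) ⟩
      Q + N                                   ∎
      where
      rearrange : ∀ a b c → a * (b * c) ≡ b * (a * c)
      rearrange = solve-∀
      N< : suc N ≤ suc (N / Q) * Q
      N< = subst (_< suc (N / Q) * Q) (sym (m≡m%n+[m/n]*n N Q)) (+-monoˡ-< (N / Q * Q) (m%n<n N Q))

    lower : k * N ≤ k * c + N
    lower = *-cancelˡ-≤ 2 (begin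
      2 * (k * N)                             ≡⟨ *-assoc 2 k N ⟨
      2 * k * N                               ≤⟨ *-monoʳ-≤ (2 * k) (≤-trans (n≤1+n N) (≤count+good M counted)) ⟩
      2 * k * (c + (L + G))                   ≡⟨ distrib k c L G ⟩
      2 * (k * c) + (2 * k * L + 2 * k * G)   ≤⟨ +-monoʳ-≤ (2 * (k * c)) (+-monoʳ-≤ (2 * k * L) good-count) ⟩
      2 * (k * c) + (2 * k * L + (Q + N))     ≡⟨ cong (λ x → 2 * (k * c) + x) (+-assoc (2 * k * L) Q N) ⟨
      2 * (k * c) + (2 * k * L + Q + N)       ≤⟨ +-monoʳ-≤ (2 * (k * c)) (+-monoˡ-≤ N (≤-trans (m≤m+n _ k) N₀≤N)) ⟩
      2 * (k * c) + (N + N)                   ≡⟨ double (k * c) N ⟩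
      2 * (k * c + N)                         ∎)
      where
      distrib : ∀ k c b g → 2 * k * (c + (b + g)) ≡ 2 * (k * c) + (2 * k * b + 2 * k * g)
      distrib = solve-∀
      double : ∀ a b → 2 * a + (b + b) ≡ 2 * (a + b)
      double = solve-∀

    upper : k * c ≤ k * N + N
    upper = begin
      k * c         ≤⟨ *-monoʳ-≤ k (count≤ counted) ⟩
      k * suc N     ≡⟨ trans (*-suc k N) (+-comm k (k * N)) ⟩
      k * N + k     ≤⟨ +-monoʳ-≤ (k * N) (≤-trans (m≤n+m k _) N₀≤N) ⟩
      k * N + N     ∎

    close : k * ∣ c - N ∣ ≤ N
    close with ≤-total c N
    ... | inj₁ c≤N = begin
      k * ∣ c - N ∣   ≡⟨ cong (k *_) (m≤n⇒∣m-n∣≡n∸m c≤N) ⟩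
      k * (N ∸ c)     ≡⟨ *-distribˡ-∸ k N c ⟩
      k * N ∸ k * c   ≤⟨ m≤n+o⇒m∸n≤o (k * N) (k * c) lower ⟩
      N               ∎
    ... | inj₂ N≤c = begin
      k * ∣ c - N ∣   ≡⟨ cong (k *_) (m≤n⇒∣n-m∣≡n∸m N≤c) ⟩
      k * (c ∸ N)     ≡⟨ *-distribˡ-∸ k c N ⟩
      k * c ∸ k * N   ≤⟨ m≤n+o⇒m∸n≤o (k * c) (k * N) upper ⟩
      N               ∎

count-within : ∀ k → 0 < k → CountWithin k
count-within k 0<k = sparse⇒count-within k (good-sparse (2 * k) (*-mono-< {0} {2} z<s 0<k))

-- Passage to rational ε

∣⊖∣≡∣-∣ : ∀ c N → ℤ.∣ c ℤ.⊖ N ∣ ≡ ∣ c - N ∣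
∣⊖∣≡∣-∣ c N with ≤-total c N
... | inj₁ c≤N = trans (ℤ.∣⊖∣-≤ c≤N) (sym (m≤n⇒∣m-n∣≡n∸m c≤N))
... | inj₂ N≤c = trans (cong ℤ.∣_∣ (ℤ.⊖-≥ N≤c)) (sym (m≤n⇒∣n-m∣≡n∸m N≤c))

-- A positive ε is at least the reciprocal of its denominator; the successor of the denominator
-- makes the inequality strict.
∣c/N-1∣<ε : ∀ ε → 0ℚ ℚ.< ε → ∀ c N .{{_ : NonZero N}} → suc (ℚ.↧ₙ ε) * ∣ c - N ∣ ≤ N →
            ℚ.∣ (ℤ.+ c ℚ./ N) ℚ.- 1ℚ ∣ ℚ.< ε
∣c/N-1∣<ε (mkℚ (ℤ.+ zero)  _ _) (*<* (ℤ.+<+ ()))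
∣c/N-1∣<ε (mkℚ ℤ.-[1+ _ ] _ _) (*<* ())
∣c/N-1∣<ε ε@(mkℚ ℤ.+[1+ a ] b _) _ c N@(suc d) close = ℚ.toℚᵘ-cancel-< (ℚᵘ.<-respˡ-≃ (ℚᵘ.≃-sym homo) (ℚᵘ.*<* core))
  where
  x : ℚᵘ.ℚᵘ
  x = ℚᵘ.mkℚᵘ (ℤ.+ c) d
  homo : ℚ.toℚᵘ ℚ.∣ (ℤ.+ c ℚ./ N) ℚ.- 1ℚ ∣ ℚᵘ.≃ ℚᵘ.∣ x ℚᵘ.- ℚᵘ.1ℚᵘ ∣
  homo = ℚᵘ.≃-trans (ℚ.toℚᵘ-homo-∣-∣ ((ℤ.+ c ℚ./ N) ℚ.- 1ℚ)) (ℚᵘ.∣-∣-cong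
    (ℚᵘ.≃-trans (ℚ.toℚᵘ-homo-+ (ℤ.+ c ℚ./ N) (ℚ.- 1ℚ)) (ℚᵘ.+-congˡ (ℚᵘ.- ℚᵘ.1ℚᵘ) (ℚ.toℚᵘ-fromℚᵘ x))))
  numerator : ℤ.∣ ℤ.+ c ℤ.* ℤ.+ 1 ℤ.+ ℤ.- (ℤ.+ 1) ℤ.* ℤ.+ N ∣ ≡ ∣ c - N ∣
  numerator = trans (cong ℤ.∣_∣ (trans (cong₂ ℤ._+_ (ℤ.*-identityʳ (ℤ.+ c)) (ℤ.-1*i≡-i (ℤ.+ N))) (ℤ.m-n≡m⊖n c N))) (∣⊖∣≡∣-∣ c N)
  strict : ∣ c - N ∣ * suc b < suc a * (N * 1)
  strict = begin-strict
    ∣ c - N ∣ * suc b         ≡⟨ *-comm ∣ c - N ∣ (suc b) ⟩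
    suc b * ∣ c - N ∣         <⟨ below ∣ c - N ∣ close ⟩
    N                         ≤⟨ m≤n*m N (suc a) ⟩
    suc a * N                 ≡⟨ cong (suc a *_) (*-identityʳ N) ⟨
    suc a * (N * 1)           ∎
    where
    open ≤-Reasoning
    below : ∀ D → suc (suc b) * D ≤ N → suc b * D < N
    -- For c = N strictness comes from N > 0 instead.
    below zero    _  = subst (_< N) (sym (*-zeroʳ b)) z<s
    below (suc D) le = <-≤-trans (*-monoˡ-< (suc D) (n<1+n (suc b))) le
  core : (ℤ.+ ℤ.∣ ℤ.+ c ℤ.* ℤ.+ 1 ℤ.+ ℤ.- (ℤ.+ 1) ℤ.* ℤ.+ N ∣) ℤ.* ℤ.+ suc b ℤ.< ℤ.+[1+ a ] ℤ.* ℤ.+ (N * 1)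
  core = subst₂ ℤ._<_ (trans (ℤ.pos-* ∣ c - N ∣ (suc b)) (cong (λ y → ℤ.+ y ℤ.* ℤ.+ suc b) (sym numerator)))
                      (ℤ.pos-* (suc a) (N * 1)) (ℤ.+<+ strict)

theorem5p2 : HasDensity FertilityNumber 1ℚ
theorem5p2 ε 0<ε =
  let (N₀ , close) = count-within (suc (ℚ.↧ₙ ε)) z<s
  in N₀ , λ N N₀≤N c counted → ∣c/N-1∣<ε ε 0<ε c N (close N N₀≤N c counted)
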